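{- Let $q$ be a prime, let $(n_m)_{m\ge 0}$ be a sequence of non-negative integers, and let $(\mathbb{F}_q^{n_m},A_m)$ be a uniform random chain complex over $\mathbb{F}_q$ with $m$-th Betti number $\beta_m$. Then for every integer $m\ge 1$ and every integer $b$, \[ \mathbb{P}[\beta_m=b]=\sum_{i_m=0}^{n_m}P^m_{i_m}(i_m-b)\sum_{i_{m-1}=0}^{n_{m-1}}P^{m-1}_{i_{m-1}}(n_m-i_m)\cdots\sum_{i_1=0}^{n_1}P^1_{i_1}(n_2-i_2)\,P^0_{n_0}(n_1-i_1). \] (The sums are nested: the right-hand side is the sum over all $(i_1,\dots,i_m)\in\prod_{\ell=1}^m\{0,\dots,n_\ell\}$ of $P^m_{i_m}(i_m-b)\prod_{\ell=1}^{m}P^{\ell-1}_{i_{\ell-1}}(n_\ell-i_\ell)$, where $i_0:=n_0$.)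
   Context: Uniform random chain complex: given a prime $q$ and non-negative integers $(n_m)_{m\ge0}$, it is a random sequence of matrices $A_m$ over $\mathbb{F}_q$ ($m\ge 0$), where $A_m$ has size $n_{m-1}\times n_m$ for $m\geq 1$ and is regarded as a linear map $\mathbb{F}_q^{n_m}\to\mathbb{F}_q^{n_{m-1}}$, and $A_0:\mathbb{F}_q^{n_0}\to 0$ is the zero map. The matrices are chosen successively: for each $m\ge0$, given $A_0,\dots,A_m$, the matrix $A_{m+1}$ is uniformly distributed over all $n_m\times n_{m+1}$ matrices over $\mathbb{F}_q$ satisfying $A_mA_{m+1}=0$ (i.e. entries i.i.d. uniform on $\mathbb{F}_q$, conditioned on $A_mA_{m+1}=0$). Betti number: $\beta_m=\operatorname{nul}(A_m)-\operatorname{rank}(A_{m+1})=\dim_{\mathbb{F}_q}(\ker A_m/\operatorname{im}A_{m+1})$, where $\operatorname{nul}$ denotes the dimension of the kernel. Notation: for integers $m\ge0$, $k\ge0$, $r\ge 0$, \[ P^m_k(r)=q^{ -kn_{m+1}}\prod_{j=0}^{r-1}\frac{(q^{n_{m+1}}-q^j)(q^k-q^j)}{q^r-q^j}, \] with the empty product equal to $1$, and $P^m_k(r)=0$ for $r<0$. -}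

module Defs where

open import Level using (0ℓ)
open import Data.Nat as ℕ using (ℕ; zero; suc; _∸_; _^_; NonZero; NonTrivial)
import Data.Nat.Properties as ℕₚ
open import Data.Nat.DivMod using (_mod_)
open import Data.Integer as ℤ using (ℤ; +_; -[1+_]; _⊖_)
open import Data.Rational as ℚ using (ℚ; 0ℚ; _/_)
import Data.Rational.Properties as ℚₚ
open import Data.Fin as Fin using (Fin; toℕ)
import Data.Fin.Properties as Finₚ
open import Data.Vec as Vec using (Vec; []; _∷_)
import Data.Vec.Properties as Vecₚ
open import Data.Vec.Relation.Unary.All as VecAll using (All)
open import Data.List as List using (List; []; _∷_; length; filter; concatMap)
open import Data.List.Relation.Unary.Any as Any using (Any; here)
import Data.List.Relation.Unary.All as ListAll
open import Data.List.Membership.Propositional using (_∈_; lose)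
open import Data.List.Membership.Propositional.Properties
  using (∈-allFin; ∈-cartesianProductWith⁺)
open import Data.Product using (∃; _×_; _,_; proj₁; proj₂)
open import Relation.Binary.Definitions using (DecidableEquality)
open import Relation.Binary.PropositionalEquality using (_≡_; refl)
open import Relation.Nullary using (Dec; yes; no)
open import Relation.Nullary.Decidable using (map′; _×-dec_; _→-dec_)
open import Relation.Unary using (Pred; Decidable)

open import Algebra.Properties.CommutativeMonoid.Sum ℚₚ.+-0-commutativeMonoid public
  using (sum; sum-syntax)
open import Algebra.Properties.CommutativeMonoid.Sum ℚₚ.*-1-commutativeMonoid public
  using () renaming (sum to product)

product-syntax : ∀ r → (Fin r → ℚ) → ℚ
product-syntax _ = product
syntax product-syntax r (λ j → x) = ∏[ j < r ] x

module _ {A : Set} {xs : List A} (complete : ∀ x → x ∈ xs)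
         {P : Pred A 0ℓ} (P? : Decidable P) where

  ∃? : Dec (∃ P)
  ∃? = map′ Any.satisfied (λ { (x , px) → lose (complete x) px }) (Any.any? P? xs)

  ∀? : Dec (∀ x → P x)
  ∀? = map′ (λ ps x → ListAll.lookup ps (complete x)) (λ f → ListAll.tabulate (λ {x} _ → f x))
            (ListAll.all? P? xs)

allVecs : {A : Set} → List A → ∀ n → List (Vec A n)
allVecs xs zero    = [] ∷ []
allVecs xs (suc n) = List.cartesianProductWith _∷_ xs (allVecs xs n)

allVecs-complete : {A : Set} {xs : List A} → (∀ x → x ∈ xs) →
                   ∀ {n} (v : Vec A n) → v ∈ allVecs xs n
allVecs-complete c []      = here refl
allVecs-complete c (x ∷ v) = ∈-cartesianProductWith⁺ _∷_ (c x) (allVecs-complete c v)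

Dist : Set → Set
Dist A = List (A × ℚ)

-- Uniform on the positions of the list, so on its elements if it has no repetitions.
uniform : {A : Set} → List A → Dist A
uniform []           = []
uniform xs@(_ ∷ xs′) = List.map (λ x → x , + 1 / suc (length xs′)) xs

infixl 1 _>>=_
_>>=_ : {A B : Set} → Dist A → (A → Dist B) → Dist B
μ >>= κ = concatMap (λ (a , p) → List.map (λ (b , p′) → b , p ℚ.* p′) (κ a)) μ

Prob : {A : Set} → Dist A → {E : Pred A 0ℓ} → Decidable E → ℚ
Prob μ E? = List.foldr ℚ._+_ 0ℚ (List.map proj₂ (filter (λ a → E? (proj₁ a)) μ))

module _ (q : ℕ) .{{_ : NonTrivial q}} where

  private
    instance
      q-nonZero : NonZero q
      q-nonZero = ℕ.nonTrivial⇒nonZero q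

  -- The integers modulo q: the field 𝔽_q when q is prime.
  F : Set
  F = Fin q

  0F : F
  0F = 0 mod q

  infixl 6 _+F_
  infixl 7 _*F_

  _+F_ _*F_ : F → F → F
  a +F b = (toℕ a ℕ.+ toℕ b) mod q
  a *F b = (toℕ a ℕ.* toℕ b) mod q

  F^ : ℕ → Set
  F^ n = Vec F n

  0V : ∀ {n} → F^ n
  0V = Vec.replicate _ 0F

  _≟V_ : ∀ {n} → DecidableEquality (F^ n)
  _≟V_ = Vecₚ.≡-dec Finₚ._≟_

  allF^ : ∀ n → List (F^ n)
  allF^ = allVecs (List.allFin q)

  allF^-complete : ∀ {n} (v : F^ n) → v ∈ allF^ n
  allF^-complete = allVecs-complete ∈-allFin

  dot : ∀ {n} → F^ n → F^ n → F
  dot u v = Vec.foldr _ _+F_ 0F (Vec.zipWith _*F_ u v)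

  lincomb : ∀ {n d} → F^ d → Vec (F^ n) d → F^ n
  lincomb c X = Vec.foldr _ (Vec.zipWith _+F_) 0V
                  (Vec.zipWith (λ a v → Vec.map (a *F_) v) c X)

  -- A matrix is the vector of its rows.
  Mat : ℕ → ℕ → Set
  Mat r c = Vec (F^ c) r

  0M : ∀ {r c} → Mat r c
  0M = Vec.replicate _ 0V

  _≟M_ : ∀ {r c} → DecidableEquality (Mat r c)
  _≟M_ = Vecₚ.≡-dec _≟V_

  allMats : ∀ r c → List (Mat r c)
  allMats r c = allVecs (allF^ c) r

  allMats-complete : ∀ {r c} (A : Mat r c) → A ∈ allMats r c
  allMats-complete = allVecs-complete allF^-complete

  mulVec : ∀ {r c} → Mat r c → F^ c → F^ r
  mulVec A x = Vec.map (λ row → dot row x) A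

  mulMat : ∀ {r s c} → Mat r s → Mat s c → Mat r c
  mulMat A B = Vec.map (λ row → Vec.map (dot row) (Vec.transpose B)) A

  LinIndep : ∀ {n d} → Vec (F^ n) d → Set
  LinIndep X = ∀ c → lincomb c X ≡ 0V → c ≡ 0V

  Spans : ∀ {n d} → Vec (F^ n) d → Pred (F^ n) 0ℓ → Set
  Spans X V = ∀ v → V v → ∃ λ c → lincomb c X ≡ v

  IsBasis : ∀ {n d} → Pred (F^ n) 0ℓ → Vec (F^ n) d → Set
  IsBasis V X = All V X × LinIndep X × Spans X V

  module _ {n : ℕ} {V : Pred (F^ n) 0ℓ} (V? : Decidable V) where

    isBasis? : ∀ {d} → Decidable (IsBasis {n} {d} V)
    isBasis? X =
      VecAll.all? V? X
      ×-dec ∀? allF^-complete (λ c → (lincomb c X ≟V 0V) →-dec (c ≟V 0V))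
      ×-dec ∀? allF^-complete (λ v → V? v →-dec ∃? allF^-complete (λ c → lincomb c X ≟V v))

    hasBasis? : ∀ d → Dec (∃ λ (X : Vec (F^ n) d) → IsBasis V X)
    hasBasis? d = ∃? allMats-complete isBasis?

    searchDim : ℕ → ℕ
    searchDim zero    = zero
    searchDim (suc d) with hasBasis? (suc d)
    ... | yes _ = suc d
    ... | no  _ = searchDim d

    -- The size of a basis of V.  For q prime and V a subspace of F^ n, a basis exists,
    -- has at most n elements, and its size does not depend on the choice.
    dim : ℕ
    dim = searchDim n

  Ker : ∀ {r c} → Mat r c → Pred (F^ c) 0ℓ
  Ker A x = mulVec A x ≡ 0V

  Im : ∀ {r c} → Mat r c → Pred (F^ r) 0ℓ
  Im A y = ∃ λ x → mulVec A x ≡ y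

  nul : ∀ {r c} → Mat r c → ℕ
  nul A = dim {V = Ker A} (λ x → mulVec A x ≟V 0V)

  rank : ∀ {r c} → Mat r c → ℕ
  rank A = dim {V = Im A} (λ y → ∃? allF^-complete (λ x → mulVec A x ≟V y))

  module _ (n : ℕ → ℕ) where

    -- n_{m-1}, where n_{-1} = 0 is the dimension of the target of A_0.
    below : ℕ → ℕ
    below zero    = 0
    below (suc m) = n m

    -- The matrices A_0, …, A_m.
    Matrices : ℕ → Set
    Matrices zero    = Mat (below 0) (n 0)
    Matrices (suc m) = Matrices m × Mat (below (suc m)) (n (suc m))

    last : ∀ m → Matrices m → Mat (below m) (n m)
    last zero    A       = A
    last (suc m) (_ , A) = A

    nextMats : ∀ {r} m → Mat r (n m) → List (Mat (n m) (n (suc m)))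
    nextMats m A = filter (λ B → mulMat A B ≟M 0M) (allMats (n m) (n (suc m)))

    -- The joint law of (A_0, …, A_m); A_0 is the zero map.
    chainLaw : ∀ m → Dist (Matrices m)
    chainLaw zero    = (0M , ℚ.1ℚ) ∷ []
    chainLaw (suc m) = chainLaw m >>= λ As →
      List.map (λ (B , p) → (As , B) , p) (uniform (nextMats m (last m As)))

    -- β_m depends on A_m and A_{m+1} only, so its law is determined by chainLaw (suc m).
    β : ∀ m → Matrices (suc m) → ℤ
    β m (As , B) = nul (last m As) ⊖ rank B

    -- For j < r the truncated subtraction q ^ r ∸ q ^ j is the true difference.
    denominator-nonZero : ∀ r (j : Fin r) → NonZero (q ^ r ∸ q ^ toℕ j)
    denominator-nonZero r j = ℕ.>-nonZero
      (ℕₚ.m<n⇒0<n∸m (ℕₚ.^-monoʳ-< q (ℕ.nonTrivial⇒n>1 q) (Finₚ.toℕ<n j)))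

    P : ℕ → ℕ → ℤ → ℚ
    P m k (+ r) =
      (+ 1 / (q ^ (k ℕ.* n (suc m)))) {{ℕₚ.m^n≢0 q (k ℕ.* n (suc m))}} ℚ.*
      ∏[ j < r ] ((((+ (q ^ n (suc m)) ℤ.- + (q ^ toℕ j)) ℤ.* (+ (q ^ k) ℤ.- + (q ^ toℕ j)))
                    / (q ^ r ∸ q ^ toℕ j)) {{denominator-nonZero r j}})
    P m k -[1+ _ ] = 0ℚ

    -- The inner nested sums:
    --   Σ_{i_l} P^l_{i_l}(r) Σ_{i_{l-1}} P^{l-1}_{i_{l-1}}(n_l - i_l) ⋯ P^0_{n_0}(n_1 - i_1).
    nested : ℕ → ℤ → ℚ
    nested zero    r = P 0 (n 0) r
    nested (suc l) r =
      ∑[ i < suc (n (suc l)) ] (P (suc l) (toℕ i) r ℚ.* nested l (n (suc l) ⊖ toℕ i))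

{-# OPTIONS --safe #-}
module Submission where

-- A subspace V of dimension k has q^k elements, and every nonempty fibre of a linear map is a
-- translate of the kernel; hence rank-nullity, and dimensions can be read off from cardinalities.
-- The columns of A_{m+1} form a uniform tuple of n_{m+1} vectors of ker A_m.  Appending a vector to
-- an s-tuple X of vectors of V keeps the dimension r of its span for q^r choices and raises it for
-- q^k - q^r, so the number N(s,r) of s-tuples spanning an r-dimensional space satisfies
--   N(s+1,r+1) = q^(r+1) N(s,r+1) + (q^k - q^r) N(s,r),
-- whose solution is the product in P.  So P^m_k is the law of rank A_{m+1} given nul A_m = k, and
-- conditioning successively on nul A_m = n_m - rank A_m produces the nested sums.

open import Defs
open import Level using (0ℓ)
open import Function using (_∘_; id)
open import Function.Bundles using (mk⇔)
open import Data.Bool using (true; false; if_then_else_)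
open import Data.Nat as ℕ using (ℕ; zero; suc; _^_; _∸_; _≤_; _<_; NonZero; NonTrivial)
import Data.Nat.Properties as ℕₚ
open import Data.Nat.Coprimality using (prime⇒coprime; coprime⇒GCD≡1)
open import Data.Nat.DivMod using (_%_; _mod_; %-distribˡ-+; %-distribˡ-*; m<n⇒m%n≡m; n%n≡0; [m+kn]%n≡m%n)
open import Data.Nat.GCD using (module Bézout)
open import Data.Nat.Primality using (Prime)
open import Data.Integer as ℤ using (ℤ; _⊖_; -[1+_])
import Data.Integer.Properties as ℤₚ
open import Data.Rational as ℚ using (ℚ; 0ℚ; 1ℚ; _/_)
import Data.Rational.Properties as ℚₚ
open import Data.Rational.Solver using (module +-*-Solver)
open import Data.Rational.Unnormalised as ℚᵘ using (mkℚᵘ; *≡*)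
import Data.Rational.Unnormalised.Properties as ℚᵘₚ
open import Data.Fin as Fin using (Fin; toℕ)
import Data.Fin.Properties as Finₚ
open import Data.Vec as Vec using (Vec; []; _∷_)
import Data.Vec.Properties as Vecₚ
open import Data.Vec.Relation.Unary.All as All using (All; []; _∷_)
import Data.Vec.Relation.Unary.All.Properties as Allₚ
open import Data.List as List using (List; []; _∷_; _++_; length; filter)
import Data.List.Properties as Listₚ
open import Data.List.Membership.Propositional using (_∈_)
open import Data.List.Membership.Propositional.Properties using (∈-allFin; ∈-map⁺)
open import Data.List.Membership.Propositional.Properties.WithK using (unique∧set⇒bag)
open import Data.List.Relation.Binary.BagAndSetEquality using (∼bag⇒↭)
open import Data.List.Relation.Binary.Permutation.Propositional as Perm using (_↭_)
import Data.List.Relation.Unary.All as ListAll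
open import Data.List.Relation.Unary.Any using (here; there)
open import Data.List.Relation.Unary.AllPairs using ([]; _∷_)
open import Data.List.Relation.Unary.Unique.Propositional using (Unique)
import Data.List.Relation.Unary.Unique.Propositional.Properties as Uniqueₚ
open import Data.Product using (∃; _×_; _,_; proj₂)
open import Data.Sum using (inj₁; inj₂)
open import Algebra.Bundles using (CommutativeRing)
import Algebra.Properties.CommutativeMonoid.Sum ℚₚ.*-1-commutativeMonoid as Product
import Algebra.Properties.Semiring.Sum (CommutativeRing.semiring ℚₚ.+-*-commutativeRing) as Sum
open import Relation.Binary.PropositionalEquality
open import Relation.Nullary using (Dec; yes; no; ¬_; does; contradiction)
open import Relation.Nullary.Decidable using (dec-true; dec-false; _×-dec_; ¬?; decidable-stable)
open import Relation.Unary using (Pred; Decidable)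

open ≡-Reasoning
open +-*-Solver using (solve; _:+_; _:*_; _:=_; _:-_; con)

-- `dim` is the outcome of a downward search for a basis, so it does not reveal its value by
-- computation. `card-dim` and `dim-unique` trade it for a cardinality, and exchange arguments are
-- replaced by comparisons of powers of `q`. Counts are kept as sums of indicators in `ℚ`: double
-- counting is then an exchange of two sums, and a difference such as q^k - q^r is a true difference
-- instead of a truncated one. Results about `ℕ` are recovered through `fromℕ-injective`. Division
-- is postponed throughout: the closed form for N(s,r) is proved after multiplication by the product
-- of the q^r - q^j with j < r, which turns the induction into polynomial identities for the ring
-- solver, and the law of the rank is compared with P after multiplication by the number of
-- admissible matrices. The matrices are stored and enumerated by rows while the counting concerns
-- columns, so sums over matrices are reindexed along transposition.

private
  variable
    A B : Set

-- Rational numbers and indicators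

module _ where

  open import Data.Rational using (_+_; _*_; _-_; -_)

  private
    -- `_/_` divides out a gcd, so equations between fractions are transported to unnormalised
    -- rationals, where they are cross-multiplied integer equations. The predecessor is there
    -- because `mkℚᵘ` stores the denominator minus one.
    toℚᵘ-/ : ∀ z d .{{_ : ℕ.NonZero d}} → ℚ.toℚᵘ (z / d) ℚᵘ.≃ mkℚᵘ z (ℕ.pred d)
    toℚᵘ-/ z (suc d) = ℚₚ.toℚᵘ-fromℚᵘ (mkℚᵘ z d)

  -- Opaque because unfolding exposes the gcd normalisation of ℚ.
  opaque
    fromℤ : ℤ → ℚ
    fromℤ z = z / 1

    fromℤ-+ : ∀ x y → fromℤ (x ℤ.+ y) ≡ fromℤ x + fromℤ y
    fromℤ-+ x y = ℚₚ.toℚᵘ-injective (ℚᵘₚ.≃-trans (toℚᵘ-/ (x ℤ.+ y) 1)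
      (ℚᵘₚ.≃-trans (*≡* (cong₂ (λ a b → (a ℤ.+ b) ℤ.* ℤ.+ 1) (sym (ℤₚ.*-identityʳ x)) (sym (ℤₚ.*-identityʳ y))))
      (ℚᵘₚ.≃-sym (ℚᵘₚ.≃-trans (ℚₚ.toℚᵘ-homo-+ (x / 1) (y / 1)) (ℚᵘₚ.+-cong (toℚᵘ-/ x 1) (toℚᵘ-/ y 1))))))

    fromℤ-* : ∀ x y → fromℤ (x ℤ.* y) ≡ fromℤ x * fromℤ y
    fromℤ-* x y = ℚₚ.toℚᵘ-injective (ℚᵘₚ.≃-trans (toℚᵘ-/ (x ℤ.* y) 1)
      (ℚᵘₚ.≃-sym (ℚᵘₚ.≃-trans (ℚₚ.toℚᵘ-homo-* (x / 1) (y / 1)) (ℚᵘₚ.*-cong (toℚᵘ-/ x 1) (toℚᵘ-/ y 1)))))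

    fromℤ-neg : ∀ x → fromℤ (ℤ.- x) ≡ - fromℤ x
    fromℤ-neg x = ℚₚ.toℚᵘ-injective (ℚᵘₚ.≃-trans (toℚᵘ-/ (ℤ.- x) 1)
      (ℚᵘₚ.≃-sym (ℚᵘₚ.≃-trans (ℚₚ.toℚᵘ-homo‿- (x / 1)) (ℚᵘₚ.-‿cong (toℚᵘ-/ x 1)))))

    fromℤ-sub : ∀ x y → fromℤ (x ℤ.- y) ≡ fromℤ x - fromℤ y
    fromℤ-sub x y = trans (fromℤ-+ x (ℤ.- y)) (cong (fromℤ x +_) (fromℤ-neg y))

    /-*-cancel : ∀ z d .{{_ : ℕ.NonZero d}} → (z / d) * fromℤ (ℤ.+ d) ≡ fromℤ z
    /-*-cancel z (suc d) = ℚₚ.toℚᵘ-injective (ℚᵘₚ.≃-trans (ℚₚ.toℚᵘ-homo-* (z / suc d) (ℤ.+ suc d / 1))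
      (ℚᵘₚ.≃-trans (ℚᵘₚ.*-cong (toℚᵘ-/ z (suc d)) (toℚᵘ-/ (ℤ.+ suc d) 1))
      (ℚᵘₚ.≃-trans (*≡* (trans (ℤₚ.*-identityʳ _) (cong (z ℤ.*_) (sym (ℤₚ.*-identityʳ (ℤ.+ suc d))))))
      (ℚᵘₚ.≃-sym (toℚᵘ-/ z 1)))))

    fromℤ-injective : ∀ {x y} → fromℤ x ≡ fromℤ y → x ≡ y
    fromℤ-injective {x} {y} eq with ℚₚ.fromℚᵘ-injective {mkℚᵘ x 0} {mkℚᵘ y 0} eq
    ... | *≡* eq′ = trans (sym (ℤₚ.*-identityʳ x)) (trans eq′ (ℤₚ.*-identityʳ y))

    fromℤ-0 : fromℤ (ℤ.+ 0) ≡ 0ℚ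
    fromℤ-0 = refl

    fromℤ-1 : fromℤ (ℤ.+ 1) ≡ 1ℚ
    fromℤ-1 = refl

  fromℕ : ℕ → ℚ
  fromℕ n = fromℤ (ℤ.+ n)

  fromℕ-injective : ∀ {m n} → fromℕ m ≡ fromℕ n → m ≡ n
  fromℕ-injective eq = ℤₚ.+-injective (fromℤ-injective eq)

  fromℕ-* : ∀ m n → fromℕ (m ℕ.* n) ≡ fromℕ m * fromℕ n
  fromℕ-* m n = trans (cong fromℤ (ℤₚ.pos-* m n)) (fromℤ-* (ℤ.+ m) (ℤ.+ n))

  *-cancelʳ-fromℕ : ∀ d .{{_ : ℕ.NonZero d}} {x y} → x * fromℕ d ≡ y * fromℕ d → x ≡ y
  *-cancelʳ-fromℕ d {x} {y} eq = begin
    x                              ≡⟨ expand x ⟩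
    x * fromℕ d * (ℤ.+ 1 / d)        ≡⟨ cong (_* (ℤ.+ 1 / d)) eq ⟩
    y * fromℕ d * (ℤ.+ 1 / d)        ≡⟨ expand y ⟨
    y                              ∎
    where
    expand : ∀ x → x ≡ x * fromℕ d * (ℤ.+ 1 / d)
    expand x = begin
      x                              ≡⟨ ℚₚ.*-identityʳ x ⟨
      x * 1ℚ                         ≡⟨ cong (x *_) (trans (/-*-cancel (ℤ.+ 1) d) fromℤ-1) ⟨
      x * ((ℤ.+ 1 / d) * fromℕ d)      ≡⟨ cong (x *_) (ℚₚ.*-comm (ℤ.+ 1 / d) (fromℕ d)) ⟩
      x * (fromℕ d * (ℤ.+ 1 / d))      ≡⟨ ℚₚ.*-assoc x (fromℕ d) (ℤ.+ 1 / d) ⟨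
      x * fromℕ d * (ℤ.+ 1 / d)        ∎

  -- Reading only `does` makes the value independent of the proof carried by the decision and lets
  -- it compute on `ℕ`: `𝟙 (suc a ℕₚ.≟ suc b)` is `𝟙 (a ℕₚ.≟ b)`, and `𝟙 (suc a ℕₚ.≟ 0)` is `0ℚ`.
  𝟙 : {P : Set} → Dec P → ℚ
  𝟙 P? = if does P? then 1ℚ else 0ℚ

  𝟙-yes : {P : Set} (P? : Dec P) → P → 𝟙 P? ≡ 1ℚ
  𝟙-yes P? p = cong (if_then 1ℚ else 0ℚ) (dec-true P? p)

  𝟙-no : {P : Set} (P? : Dec P) → ¬ P → 𝟙 P? ≡ 0ℚ
  𝟙-no P? ¬p = cong (if_then 1ℚ else 0ℚ) (dec-false P? ¬p)

  𝟙-cong : {P Q : Set} (P? : Dec P) (Q? : Dec Q) → (P → Q) → (Q → P) → 𝟙 P? ≡ 𝟙 Q?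
  𝟙-cong (yes p) Q? f g = sym (𝟙-yes Q? (f p))
  𝟙-cong (no ¬p) Q? f g = sym (𝟙-no Q? (¬p ∘ g))

  𝟙-× : {P Q : Set} (P? : Dec P) (Q? : Dec Q) → 𝟙 (P? ×-dec Q?) ≡ 𝟙 P? * 𝟙 Q?
  𝟙-× P? Q? with does P? | does Q?
  ... | true  | true  = refl
  ... | true  | false = refl
  ... | false | true  = refl
  ... | false | false = refl

  -- For equations that hold only where the indicator is 1. It brings the assumption `All V X` into
  -- a sum over all tuples, and replaces `spanDim X` by `r` under its indicator.
  𝟙-subst : {P : Set} (P? : Dec P) {x y : ℚ} → (P → x ≡ y) → 𝟙 P? * x ≡ 𝟙 P? * y
  𝟙-subst (yes p) eq = cong (1ℚ *_) (eq p)
  𝟙-subst (no ¬p) {x} {y} eq = trans (ℚₚ.*-zeroˡ x) (sym (ℚₚ.*-zeroˡ y))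

  -- Finite sums over lists

  ∑ˡ : List A → (A → ℚ) → ℚ
  ∑ˡ []       f = 0ℚ
  ∑ˡ (x ∷ xs) f = f x + ∑ˡ xs f

  ∑ˡ-cong : (xs : List A) {f g : A → ℚ} → (∀ x → f x ≡ g x) → ∑ˡ xs f ≡ ∑ˡ xs g
  ∑ˡ-cong []       eq = refl
  ∑ˡ-cong (x ∷ xs) eq = cong₂ _+_ (eq x) (∑ˡ-cong xs eq)

  ∑ˡ-zero : (xs : List A) → ∑ˡ xs (λ _ → 0ℚ) ≡ 0ℚ
  ∑ˡ-zero []       = refl
  ∑ˡ-zero (x ∷ xs) = trans (ℚₚ.+-identityˡ _) (∑ˡ-zero xs)

  ∑ˡ-+ : (xs : List A) (f g : A → ℚ) → ∑ˡ xs (λ x → f x + g x) ≡ ∑ˡ xs f + ∑ˡ xs g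
  ∑ˡ-+ []       f g = refl
  ∑ˡ-+ (x ∷ xs) f g = begin
    f x + g x + ∑ˡ xs (λ x → f x + g x)  ≡⟨ cong (f x + g x +_) (∑ˡ-+ xs f g) ⟩
    f x + g x + (∑ˡ xs f + ∑ˡ xs g)      ≡⟨ solve 4 (λ a b c d → a :+ b :+ (c :+ d) := a :+ c :+ (b :+ d)) refl
                                              (f x) (g x) (∑ˡ xs f) (∑ˡ xs g) ⟩
    f x + ∑ˡ xs f + (g x + ∑ˡ xs g)      ∎

  ∑ˡ-*ˡ : (xs : List A) (c : ℚ) (f : A → ℚ) → ∑ˡ xs (λ x → c * f x) ≡ c * ∑ˡ xs f
  ∑ˡ-*ˡ []       c f = sym (ℚₚ.*-zeroʳ c)
  ∑ˡ-*ˡ (x ∷ xs) c f = trans (cong (c * f x +_) (∑ˡ-*ˡ xs c f)) (sym (ℚₚ.*-distribˡ-+ c (f x) (∑ˡ xs f)))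

  ∑ˡ-*ʳ : (xs : List A) (f : A → ℚ) (c : ℚ) → ∑ˡ xs (λ x → f x * c) ≡ ∑ˡ xs f * c
  ∑ˡ-*ʳ xs f c = begin
    ∑ˡ xs (λ x → f x * c)  ≡⟨ ∑ˡ-cong xs (λ x → ℚₚ.*-comm (f x) c) ⟩
    ∑ˡ xs (λ x → c * f x)  ≡⟨ ∑ˡ-*ˡ xs c f ⟩
    c * ∑ˡ xs f            ≡⟨ ℚₚ.*-comm c _ ⟩
    ∑ˡ xs f * c            ∎

  ∑ˡ-++ : (xs ys : List A) (f : A → ℚ) → ∑ˡ (xs ++ ys) f ≡ ∑ˡ xs f + ∑ˡ ys f
  ∑ˡ-++ []       ys f = sym (ℚₚ.+-identityˡ _)
  ∑ˡ-++ (x ∷ xs) ys f = trans (cong (f x +_) (∑ˡ-++ xs ys f)) (sym (ℚₚ.+-assoc (f x) _ _))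

  ∑ˡ-map : (h : A → B) (xs : List A) (f : B → ℚ) → ∑ˡ (List.map h xs) f ≡ ∑ˡ xs (f ∘ h)
  ∑ˡ-map h []       f = refl
  ∑ˡ-map h (x ∷ xs) f = cong (f (h x) +_) (∑ˡ-map h xs f)

  ∑ˡ-concatMap : (h : A → List B) (xs : List A) (f : B → ℚ) →
                 ∑ˡ (List.concatMap h xs) f ≡ ∑ˡ xs (λ x → ∑ˡ (h x) f)
  ∑ˡ-concatMap h []       f = refl
  ∑ˡ-concatMap h (x ∷ xs) f = trans (∑ˡ-++ (h x) _ f) (cong (∑ˡ (h x) f +_) (∑ˡ-concatMap h xs f))

  ∑ˡ-cartesianProductWith : {C : Set} (h : A → B → C) (xs : List A) (ys : List B) (f : C → ℚ) →
    ∑ˡ (List.cartesianProductWith h xs ys) f ≡ ∑ˡ xs (λ x → ∑ˡ ys (λ y → f (h x y)))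
  ∑ˡ-cartesianProductWith h []       ys f = refl
  ∑ˡ-cartesianProductWith h (x ∷ xs) ys f =
    trans (∑ˡ-++ (List.map (h x) ys) _ f)
          (cong₂ _+_ (∑ˡ-map (h x) ys f) (∑ˡ-cartesianProductWith h xs ys f))

  ∑ˡ-comm : (xs : List A) (ys : List B) (f : A → B → ℚ) →
            ∑ˡ xs (λ x → ∑ˡ ys (f x)) ≡ ∑ˡ ys (λ y → ∑ˡ xs (λ x → f x y))
  ∑ˡ-comm []       ys f = sym (∑ˡ-zero ys)
  ∑ˡ-comm (x ∷ xs) ys f = trans (cong (∑ˡ ys (f x) +_) (∑ˡ-comm xs ys f)) (sym (∑ˡ-+ ys (f x) _))

  ∑ˡ-filter : {P : Pred A 0ℓ} (P? : Decidable P) (xs : List A) (f : A → ℚ) →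
              ∑ˡ (filter P? xs) f ≡ ∑ˡ xs (λ x → 𝟙 (P? x) * f x)
  ∑ˡ-filter P? []       f = refl
  ∑ˡ-filter P? (x ∷ xs) f with does (P? x)
  ... | true  = cong₂ _+_ (sym (ℚₚ.*-identityˡ (f x))) (∑ˡ-filter P? xs f)
  ... | false = trans (∑ˡ-filter P? xs f)
                  (sym (trans (cong (_+ rest) (ℚₚ.*-zeroˡ (f x))) (ℚₚ.+-identityˡ rest)))
    where rest = ∑ˡ xs (λ x → 𝟙 (P? x) * f x)

  ∑ˡ-length : (xs : List A) → ∑ˡ xs (λ _ → 1ℚ) ≡ fromℕ (length xs)
  ∑ˡ-length []       = sym fromℤ-0
  ∑ˡ-length (x ∷ xs) = trans (cong₂ _+_ (sym fromℤ-1) (∑ˡ-length xs)) (sym (fromℤ-+ (ℤ.+ 1) (ℤ.+ length xs)))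

  ∑ˡ-↭ : {xs ys : List A} (f : A → ℚ) → xs ↭ ys → ∑ˡ xs f ≡ ∑ˡ ys f
  ∑ˡ-↭ f Perm.refl         = refl
  ∑ˡ-↭ f (Perm.prep x p)   = cong (f x +_) (∑ˡ-↭ f p)
  ∑ˡ-↭ f (Perm.swap {ys = ys} x y p) =
    trans (cong (λ s → f x + (f y + s)) (∑ˡ-↭ f p))
          (solve 3 (λ a b c → a :+ (b :+ c) := b :+ (a :+ c)) refl (f x) (f y) (∑ˡ ys f))
  ∑ˡ-↭ f (Perm.trans p q)  = trans (∑ˡ-↭ f p) (∑ˡ-↭ f q)

  record Enumerates (xs : List A) : Set where
    constructor enumerates
    field
      unique   : Unique xs
      complete : ∀ x → x ∈ xs

  open Enumerates public

  -- Two lists without repetitions that have the same members are permutations of each other. The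
  -- image of `xs` under the injective `h` and the list `ys` are such a pair.
  ∑ˡ-reindex : {xs : List A} {ys : List B} → Enumerates xs → Enumerates ys →
               (h : A → B) (h⁻¹ : B → A) → (∀ x → h⁻¹ (h x) ≡ x) → (∀ y → h (h⁻¹ y) ≡ y) →
               (f : B → ℚ) → ∑ˡ xs (f ∘ h) ≡ ∑ˡ ys f
  ∑ˡ-reindex {xs = xs} {ys} ex ey h h⁻¹ left right f =
    trans (sym (∑ˡ-map h xs f)) (∑ˡ-↭ f (∼bag⇒↭ (unique∧set⇒bag
      (Uniqueₚ.map⁺ (λ {x} {y} eq → trans (sym (left x)) (trans (cong h⁻¹ eq) (left y))) (unique ex))
      (unique ey)
      (mk⇔ (λ _ → complete ey _) (λ _ → subst (_∈ List.map h xs) (right _) (∈-map⁺ h (complete ex (h⁻¹ _))))))))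

  ∑ˡ-𝟙≡1 : {P : Pred A 0ℓ} (P? : Decidable P) {xs : List A} {a : A} → Unique xs → a ∈ xs →
           P a → (∀ {x} → P x → x ≡ a) → ∑ˡ xs (λ x → 𝟙 (P? x)) ≡ 1ℚ
  ∑ˡ-𝟙≡1 P? {x ∷ xs} {a} (x∉xs ∷ u) (here refl) pa only =
    trans (cong₂ _+_ (𝟙-yes (P? x) pa) (zeros x∉xs)) (ℚₚ.+-identityʳ 1ℚ)
    where
    zeros : ∀ {ys} → ListAll.All (λ y → ¬ a ≡ y) ys → ∑ˡ ys (λ x → 𝟙 (P? x)) ≡ 0ℚ
    zeros ListAll.[]           = refl
    zeros (a≢y ListAll.∷ rest) = trans (cong₂ _+_ (𝟙-no (P? _) (a≢y ∘ sym ∘ only)) (zeros rest)) (ℚₚ.+-identityʳ 0ℚ)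
  ∑ˡ-𝟙≡1 P? {x ∷ xs} (x∉xs ∷ u) (there a∈xs) pa only =
    trans (cong₂ _+_ (𝟙-no (P? x) (ListAll.lookup x∉xs a∈xs ∘ only)) (∑ˡ-𝟙≡1 P? u a∈xs pa only)) (ℚₚ.+-identityˡ 1ℚ)

  -- Expectations

  𝔼 : Dist A → (A → ℚ) → ℚ
  𝔼 μ f = ∑ˡ μ (λ (a , p) → p * f a)

  𝔼-cong : (μ : Dist A) {f g : A → ℚ} → (∀ a → f a ≡ g a) → 𝔼 μ f ≡ 𝔼 μ g
  𝔼-cong μ eq = ∑ˡ-cong μ (λ (a , p) → cong (p *_) (eq a))

  Prob≡𝔼 : (μ : Dist A) {E : Pred A 0ℓ} (E? : Decidable E) → Prob μ E? ≡ 𝔼 μ (λ a → 𝟙 (E? a))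
  Prob≡𝔼 []            E? = refl
  Prob≡𝔼 ((a , p) ∷ μ) E? with does (E? a)
  ... | true  = cong₂ _+_ (sym (ℚₚ.*-identityʳ p)) (Prob≡𝔼 μ E?)
  ... | false = trans (Prob≡𝔼 μ E?) (sym (trans (cong (_+ rest) (ℚₚ.*-zeroʳ p)) (ℚₚ.+-identityˡ rest)))
    where rest = 𝔼 μ (λ a → 𝟙 (E? a))

  𝔼->>= : (μ : Dist A) (κ : A → Dist B) (f : B → ℚ) → 𝔼 (μ >>= κ) f ≡ 𝔼 μ (λ a → 𝔼 (κ a) f)
  𝔼->>= μ κ f = trans (∑ˡ-concatMap _ μ _) (∑ˡ-cong μ (λ (a , p) → begin
    ∑ˡ (List.map (λ (b , p′) → b , p * p′) (κ a)) (λ (b , p) → p * f b)  ≡⟨ ∑ˡ-map _ (κ a) _ ⟩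
    ∑ˡ (κ a) (λ (b , p′) → p * p′ * f b)                                ≡⟨ ∑ˡ-cong (κ a) (λ (b , p′) → ℚₚ.*-assoc p p′ (f b)) ⟩
    ∑ˡ (κ a) (λ (b , p′) → p * (p′ * f b))                              ≡⟨ ∑ˡ-*ˡ (κ a) p _ ⟩
    p * 𝔼 (κ a) f                                                       ∎))

  𝔼-map : (h : A → B) (μ : Dist A) (f : B → ℚ) → 𝔼 (List.map (λ (a , p) → h a , p) μ) f ≡ 𝔼 μ (f ∘ h)
  𝔼-map h μ f = ∑ˡ-map _ μ _

  -- Multiplying by the length, rather than dividing by it, covers the empty list, on which
  -- `uniform` has no mass.
  𝔼-uniform : (xs : List A) (f : A → ℚ) → 𝔼 (uniform xs) f * fromℕ (List.length xs) ≡ ∑ˡ xs f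
  𝔼-uniform []           f = ℚₚ.*-zeroˡ (fromℕ 0)
  𝔼-uniform xs@(_ ∷ xs′) f = begin
    𝔼 (uniform xs) f * N      ≡⟨ cong (_* N) (trans (∑ˡ-map (λ x → x , w) xs (λ (a , p) → p * f a)) (∑ˡ-*ˡ xs w f)) ⟩
    w * ∑ˡ xs f * N           ≡⟨ solve 3 (λ a b c → a :* b :* c := a :* c :* b) refl w (∑ˡ xs f) N ⟩
    w * N * ∑ˡ xs f           ≡⟨ cong (_* ∑ˡ xs f) (trans (/-*-cancel (ℤ.+ 1) (suc (List.length xs′))) fromℤ-1) ⟩
    1ℚ * ∑ˡ xs f              ≡⟨ ℚₚ.*-identityˡ _ ⟩
    ∑ˡ xs f                   ∎
    where
    N = fromℕ (List.length xs)
    w = ℤ.+ 1 / suc (List.length xs′)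

  𝔼-sum : (μ : Dist A) (N : ℕ) (h : Fin N → A → ℚ) → 𝔼 μ (λ a → ∑[ i < N ] h i a) ≡ ∑[ i < N ] 𝔼 μ (h i)
  𝔼-sum []            N h = sym (Sum.sum-replicate-zero N)
  𝔼-sum ((a , p) ∷ μ) N h = trans (cong₂ _+_ (Sum.*-distribˡ-sum {N} p (λ i → h i a)) (𝔼-sum μ N h))
                                  (sym (Sum.∑-distrib-+ {N} (λ i → p * h i a) (λ i → 𝔼 μ (h i))))

  -- Read from right to left, it splits `g k` according to the value of `k`; this is how an
  -- expectation is conditioned on the nullity.
  sum-𝟙 : ∀ N (g : ℕ → ℚ) {k} → k < N → ∑[ i < N ] (g (toℕ i) * 𝟙 (k ℕₚ.≟ toℕ i)) ≡ g k
  sum-𝟙 (suc N) g {zero}  _   = begin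
    g 0 * 1ℚ + ∑[ i < N ] (g (suc (toℕ i)) * 0ℚ)  ≡⟨ cong₂ _+_ (ℚₚ.*-identityʳ (g 0))
                                                        (trans (Sum.sum-cong-≗ {N} (λ i → ℚₚ.*-zeroʳ (g (suc (toℕ i)))))
                                                               (Sum.sum-replicate-zero N)) ⟩
    g 0 + 0ℚ                                       ≡⟨ ℚₚ.+-identityʳ (g 0) ⟩
    g 0                                            ∎
  sum-𝟙 (suc N) g {suc k} k<N =
    trans (cong₂ _+_ (ℚₚ.*-zeroʳ (g 0)) (sum-𝟙 N (g ∘ suc) (ℕ.s<s⁻¹ k<N))) (ℚₚ.+-identityˡ (g (suc k)))

  -- Gathers the denominators of P into one nonzero natural number, the form that `*-cancelʳ-fromℕ`
  -- can cancel.
  product-fromℕ : ∀ r (d : Fin r → ℕ) → (∀ j → NonZero (d j)) →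
                  ∃ λ D → NonZero D × product (λ j → fromℕ (d j)) ≡ fromℕ D
  product-fromℕ zero    d d≢0 = 1 , _ , sym fromℤ-1
  product-fromℕ (suc r) d d≢0 with product-fromℕ r (d ∘ Fin.suc) (d≢0 ∘ Fin.suc)
  ... | D , D≢0 , eq = d Fin.zero ℕ.* D , ℕₚ.m*n≢0 (d Fin.zero) D {{d≢0 Fin.zero}} {{D≢0}} ,
                       trans (cong (fromℕ (d Fin.zero) *_) eq) (sym (fromℕ-* (d Fin.zero) D))


-- Enumeration of vectors, and transposition

allVecs-enumerates : {A : Set} {xs : List A} → Enumerates xs → ∀ n → Enumerates (allVecs xs n)
allVecs-enumerates {xs = xs} e n = enumerates (uniq n) (allVecs-complete (complete e))
  where
  uniq : ∀ n → Unique (allVecs xs n)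
  uniq zero    = ListAll.[] ∷ []
  uniq (suc n) = Uniqueₚ.cartesianProductWith⁺ _∷_ Vecₚ.∷-injective (unique e) (uniq n)

∑ˡ-allVecs-suc : {A : Set} (xs : List A) (n : ℕ) (f : Vec A (suc n) → ℚ) →
                 ∑ˡ (allVecs xs (suc n)) f ≡ ∑ˡ xs (λ x → ∑ˡ (allVecs xs n) (λ v → f (x ∷ v)))
∑ˡ-allVecs-suc xs n f = ∑ˡ-cartesianProductWith _∷_ xs (allVecs xs n) f

lookup-extensional : ∀ {n} {u v : Vec A n} → (∀ i → Vec.lookup u i ≡ Vec.lookup v i) → u ≡ v
lookup-extensional {u = u} {v} eq =
  trans (sym (Vecₚ.tabulate∘lookup u)) (trans (Vecₚ.tabulate-cong eq) (Vecₚ.tabulate∘lookup v))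

lookup-transpose : ∀ {r c} (M : Vec (Vec A c) r) j →
                   Vec.lookup (Vec.transpose M) j ≡ Vec.map (λ row → Vec.lookup row j) M
lookup-transpose []        j = Vecₚ.lookup-replicate j []
lookup-transpose {A} {suc r} {c} (row ∷ M) j = begin
  Vec.lookup ((Vec.replicate c cons Vec.⊛ row) Vec.⊛ Vec.transpose M) j
    ≡⟨ Vecₚ.lookup-⊛ j (Vec.replicate c cons Vec.⊛ row) (Vec.transpose M) ⟩
  Vec.lookup (Vec.replicate c cons Vec.⊛ row) j (Vec.lookup (Vec.transpose M) j)
    ≡⟨ cong (λ f → f (Vec.lookup (Vec.transpose M) j)) (Vecₚ.lookup-⊛ j (Vec.replicate c cons) row) ⟩
  Vec.lookup (Vec.replicate c cons) j (Vec.lookup row j) (Vec.lookup (Vec.transpose M) j)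
    ≡⟨ cong₂ (λ f → f (Vec.lookup row j)) (Vecₚ.lookup-replicate j cons) (lookup-transpose M j) ⟩
  Vec.lookup row j ∷ Vec.map (λ row → Vec.lookup row j) M ∎
  where
  cons : A → Vec A r → Vec A (suc r)
  cons = _∷_

lookup²-transpose : ∀ {r c} (M : Vec (Vec A c) r) i j →
                    Vec.lookup (Vec.lookup (Vec.transpose M) j) i ≡ Vec.lookup (Vec.lookup M i) j
lookup²-transpose M i j = trans (cong (λ v → Vec.lookup v i) (lookup-transpose M j)) (Vecₚ.lookup-map i _ M)

transpose-involutive : ∀ {r c} (M : Vec (Vec A c) r) → Vec.transpose (Vec.transpose M) ≡ M
transpose-involutive M = lookup-extensional (λ i → lookup-extensional (λ j →
  trans (lookup²-transpose (Vec.transpose M) j i) (lookup²-transpose M i j)))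

-- The prime field and its coordinate spaces

module Field (q : ℕ) .{{_ : NonTrivial q}} (q-prime : Prime q) where

  open import Data.Nat using (_+_; _*_)

  instance
    q-nonZero : NonZero q
    q-nonZero = ℕ.nonTrivial⇒nonZero q

  infixl 5 _⊞_
  infixl 6 _⊠_

  _⊞_ _⊠_ : F q → F q → F q
  _⊞_ = _+F_ q
  _⊠_ = _*F_ q

  mod-cong : ∀ {m n} → m % q ≡ n % q → m mod q ≡ n mod q
  mod-cong eq = Finₚ.fromℕ<-cong _ _ eq _ _

  toℕ-mod : ∀ m → toℕ (m mod q) ≡ m % q
  toℕ-mod m = Finₚ.toℕ-fromℕ< _

  mod-toℕ : ∀ a → toℕ a mod q ≡ a
  mod-toℕ a = Finₚ.toℕ-injective (trans (toℕ-mod (toℕ a)) (m<n⇒m%n≡m (Finₚ.toℕ<n a)))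

  mod-⊞ : ∀ m n → m mod q ⊞ n mod q ≡ (m + n) mod q
  mod-⊞ m n = mod-cong (trans (cong₂ (λ a b → (a + b) % q) (toℕ-mod m) (toℕ-mod n))
                              (sym (%-distribˡ-+ m n q)))

  mod-⊠ : ∀ m n → m mod q ⊠ n mod q ≡ (m * n) mod q
  mod-⊠ m n = mod-cong (trans (cong₂ (λ a b → (a * b) % q) (toℕ-mod m) (toℕ-mod n))
                              (sym (%-distribˡ-* m n q)))

  mod-⊞ˡ : ∀ m a → m mod q ⊞ a ≡ (m + toℕ a) mod q
  mod-⊞ˡ m a = trans (cong (m mod q ⊞_) (sym (mod-toℕ a))) (mod-⊞ m (toℕ a))

  mod-⊠ˡ : ∀ m a → m mod q ⊠ a ≡ (m * toℕ a) mod q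
  mod-⊠ˡ m a = trans (cong (m mod q ⊠_) (sym (mod-toℕ a))) (mod-⊠ m (toℕ a))

  ⊞-comm : ∀ a b → a ⊞ b ≡ b ⊞ a
  ⊞-comm a b = cong (_mod q) (ℕₚ.+-comm (toℕ a) (toℕ b))

  ⊠-comm : ∀ a b → a ⊠ b ≡ b ⊠ a
  ⊠-comm a b = cong (_mod q) (ℕₚ.*-comm (toℕ a) (toℕ b))

  ⊞-assoc : ∀ a b c → (a ⊞ b) ⊞ c ≡ a ⊞ (b ⊞ c)
  ⊞-assoc a b c = begin
    (a ⊞ b) ⊞ c                       ≡⟨ mod-⊞ˡ (toℕ a + toℕ b) c ⟩
    -- `mod-⊞ˡ` merges a reduced left operand only. Hence the sum is rotated to `b`, `c`, `a`, and
    -- commutativity then gives the other bracketing.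
    (toℕ a + toℕ b + toℕ c) mod q     ≡⟨ cong (_mod q) (trans (ℕₚ.+-assoc (toℕ a) _ _) (ℕₚ.+-comm (toℕ a) _)) ⟩
    (toℕ b + toℕ c + toℕ a) mod q     ≡⟨ mod-⊞ˡ (toℕ b + toℕ c) a ⟨
    (b ⊞ c) ⊞ a                       ≡⟨ ⊞-comm (b ⊞ c) a ⟩
    a ⊞ (b ⊞ c)                       ∎

  ⊠-assoc : ∀ a b c → (a ⊠ b) ⊠ c ≡ a ⊠ (b ⊠ c)
  ⊠-assoc a b c = begin
    (a ⊠ b) ⊠ c                       ≡⟨ mod-⊠ˡ (toℕ a * toℕ b) c ⟩
    (toℕ a * toℕ b * toℕ c) mod q     ≡⟨ cong (_mod q) (trans (ℕₚ.*-assoc (toℕ a) _ _) (ℕₚ.*-comm (toℕ a) _)) ⟩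
    (toℕ b * toℕ c * toℕ a) mod q     ≡⟨ mod-⊠ˡ (toℕ b * toℕ c) a ⟨
    (b ⊠ c) ⊠ a                       ≡⟨ ⊠-comm (b ⊠ c) a ⟩
    a ⊠ (b ⊠ c)                       ∎

  ⊠-distribʳ : ∀ c a b → (a ⊞ b) ⊠ c ≡ a ⊠ c ⊞ b ⊠ c
  ⊠-distribʳ c a b = begin
    (a ⊞ b) ⊠ c                                ≡⟨ mod-⊠ˡ (toℕ a + toℕ b) c ⟩
    ((toℕ a + toℕ b) * toℕ c) mod q            ≡⟨ cong (_mod q) (ℕₚ.*-distribʳ-+ (toℕ c) (toℕ a) (toℕ b)) ⟩
    (toℕ a * toℕ c + toℕ b * toℕ c) mod q      ≡⟨ mod-⊞ (toℕ a * toℕ c) (toℕ b * toℕ c) ⟨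
    a ⊠ c ⊞ b ⊠ c                              ∎

  ⊠-distribˡ : ∀ a b c → a ⊠ (b ⊞ c) ≡ a ⊠ b ⊞ a ⊠ c
  ⊠-distribˡ a b c = trans (⊠-comm a (b ⊞ c))
    (trans (⊠-distribʳ a b c) (cong₂ _⊞_ (⊠-comm b a) (⊠-comm c a)))

  1F : F q
  1F = 1 mod q

  ⊞-identityˡ : ∀ a → 0F q ⊞ a ≡ a
  ⊞-identityˡ a = trans (mod-⊞ˡ 0 a) (mod-toℕ a)

  ⊞-identityʳ : ∀ a → a ⊞ 0F q ≡ a
  ⊞-identityʳ a = trans (⊞-comm a (0F q)) (⊞-identityˡ a)

  ⊠-zeroˡ : ∀ a → 0F q ⊠ a ≡ 0F q
  ⊠-zeroˡ a = mod-⊠ˡ 0 a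

  ⊠-zeroʳ : ∀ a → a ⊠ 0F q ≡ 0F q
  ⊠-zeroʳ a = trans (⊠-comm a (0F q)) (⊠-zeroˡ a)

  ⊠-identityˡ : ∀ a → 1F ⊠ a ≡ a
  ⊠-identityˡ a = trans (mod-⊠ˡ 1 a) (trans (cong (_mod q) (ℕₚ.*-identityˡ (toℕ a))) (mod-toℕ a))

  neg : F q → F q
  neg a = (q ∸ toℕ a) mod q

  q-mod : q mod q ≡ 0F q
  q-mod = mod-cong (trans (n%n≡0 q) (sym (m<n⇒m%n≡m (ℕ.>-nonZero⁻¹ q))))

  ⊞-inverseˡ : ∀ a → neg a ⊞ a ≡ 0F q
  ⊞-inverseˡ a = trans (mod-⊞ˡ (q ∸ toℕ a) a)
    (trans (cong (_mod q) (ℕₚ.m∸n+n≡m (ℕₚ.<⇒≤ (Finₚ.toℕ<n a)))) q-mod)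

  ⊞-inverseʳ : ∀ a → a ⊞ neg a ≡ 0F q
  ⊞-inverseʳ a = trans (⊞-comm a (neg a)) (⊞-inverseˡ a)

  neg-⊠ : ∀ a b → neg a ⊠ b ≡ neg (a ⊠ b)
  neg-⊠ a b = begin
    neg a ⊠ b                                ≡⟨ ⊞-identityʳ _ ⟨
    neg a ⊠ b ⊞ 0F q                         ≡⟨ cong (neg a ⊠ b ⊞_) (⊞-inverseʳ (a ⊠ b)) ⟨
    neg a ⊠ b ⊞ (a ⊠ b ⊞ neg (a ⊠ b))        ≡⟨ ⊞-assoc _ _ _ ⟨
    neg a ⊠ b ⊞ a ⊠ b ⊞ neg (a ⊠ b)          ≡⟨ cong (_⊞ neg (a ⊠ b)) (⊠-distribʳ b (neg a) a) ⟨
    (neg a ⊞ a) ⊠ b ⊞ neg (a ⊠ b)            ≡⟨ cong (λ x → x ⊠ b ⊞ neg (a ⊠ b)) (⊞-inverseˡ a) ⟩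
    0F q ⊠ b ⊞ neg (a ⊠ b)                   ≡⟨ cong (_⊞ neg (a ⊠ b)) (⊠-zeroˡ b) ⟩
    0F q ⊞ neg (a ⊠ b)                       ≡⟨ ⊞-identityˡ _ ⟩
    neg (a ⊠ b)                              ∎

  neg-involutive : ∀ a → neg (neg a) ≡ a
  neg-involutive a = begin
    neg (neg a)                    ≡⟨ ⊞-identityʳ _ ⟨
    neg (neg a) ⊞ 0F q             ≡⟨ cong (neg (neg a) ⊞_) (⊞-inverseˡ a) ⟨
    neg (neg a) ⊞ (neg a ⊞ a)      ≡⟨ ⊞-assoc _ _ _ ⟨
    neg (neg a) ⊞ neg a ⊞ a        ≡⟨ cong (_⊞ a) (⊞-inverseˡ (neg a)) ⟩
    0F q ⊞ a                       ≡⟨ ⊞-identityˡ a ⟩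
    a                              ∎

  -- The one place where primality is invoked: a nonzero residue is coprime to `q`, and Bézout gives
  -- either `1 + x * q ≡ y * toℕ a`, with inverse `y`, or `1 + y * toℕ a ≡ x * q`, with inverse
  -- `-y`.
  ⊠-inverse : ∀ a → a ≢ 0F q → ∃ λ b → b ⊠ a ≡ 1F
  ⊠-inverse a a≢0 = helper (Bézout.identity (coprime⇒GCD≡1 (prime⇒coprime q-prime (Finₚ.toℕ<n a))))
    where
    instance
      a-nonZero : NonZero (toℕ a)
      a-nonZero = ℕ.≢-nonZero (λ eq → a≢0 (trans (sym (mod-toℕ a)) (cong (_mod q) eq)))
    y*q : ∀ y → (1 + y * q) mod q ≡ 1F
    y*q y = mod-cong ([m+kn]%n≡m%n 1 y q)
    helper : Bézout.Identity 1 q (toℕ a) → ∃ λ b → b ⊠ a ≡ 1F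
    helper (Bézout.-+ x y eq) = y mod q , trans (mod-⊠ˡ y a) (trans (cong (_mod q) (sym eq)) (y*q x))
    helper (Bézout.+- x y eq) = neg (y mod q) , (begin
      neg (y mod q) ⊠ a            ≡⟨ neg-⊠ (y mod q) a ⟩
      neg (y mod q ⊠ a)            ≡⟨ cong neg (mod-⊠ˡ y a) ⟩
      neg (z mod q)                ≡⟨ ⊞-identityˡ _ ⟨
      0F q ⊞ neg (z mod q)         ≡⟨ cong (_⊞ neg (z mod q)) zero-sum ⟨
      1F ⊞ z mod q ⊞ neg (z mod q) ≡⟨ ⊞-assoc _ _ _ ⟩
      1F ⊞ (z mod q ⊞ neg (z mod q)) ≡⟨ cong (1F ⊞_) (⊞-inverseʳ _) ⟩
      1F ⊞ 0F q                    ≡⟨ ⊞-identityʳ 1F ⟩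
      1F                           ∎)
      where
      z = y * toℕ a
      zero-sum : 1F ⊞ z mod q ≡ 0F q
      zero-sum = trans (mod-⊞ 1 z) (trans (cong (_mod q) eq)
        (mod-cong ([m+kn]%n≡m%n 0 x q)))

  infixl 5 _⊕_
  infixr 6 _·_

  _⊕_ : ∀ {n} → F^ q n → F^ q n → F^ q n
  _⊕_ = Vec.zipWith _⊞_

  _·_ : ∀ {n} → F q → F^ q n → F^ q n
  a · v = Vec.map (a ⊠_) v

  ⊕-assoc : ∀ {n} (u v w : F^ q n) → (u ⊕ v) ⊕ w ≡ u ⊕ (v ⊕ w)
  ⊕-assoc = Vecₚ.zipWith-assoc ⊞-assoc

  ⊕-comm : ∀ {n} (u v : F^ q n) → u ⊕ v ≡ v ⊕ u
  ⊕-comm = Vecₚ.zipWith-comm ⊞-comm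

  ⊕-identityˡ : ∀ {n} (u : F^ q n) → 0V q ⊕ u ≡ u
  ⊕-identityˡ = Vecₚ.zipWith-identityˡ ⊞-identityˡ

  ⊕-identityʳ : ∀ {n} (u : F^ q n) → u ⊕ 0V q ≡ u
  ⊕-identityʳ = Vecₚ.zipWith-identityʳ ⊞-identityʳ

  ⊖_ : ∀ {n} → F^ q n → F^ q n
  ⊖ v = Vec.map neg v

  ⊕-inverseˡ : ∀ {n} (u : F^ q n) → (⊖ u) ⊕ u ≡ 0V q
  ⊕-inverseˡ = Vecₚ.zipWith-inverseˡ ⊞-inverseˡ

  ⊕-inverseʳ : ∀ {n} (u : F^ q n) → u ⊕ (⊖ u) ≡ 0V q
  ⊕-inverseʳ = Vecₚ.zipWith-inverseʳ ⊞-inverseʳ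

  ⊕-cancel-⊖ˡ : ∀ {n} (u v : F^ q n) → (⊖ u) ⊕ (u ⊕ v) ≡ v
  ⊕-cancel-⊖ˡ u v = trans (sym (⊕-assoc (⊖ u) u v)) (trans (cong (_⊕ v) (⊕-inverseˡ u)) (⊕-identityˡ v))

  ⊕-cancel-⊖ʳ : ∀ {n} (u v : F^ q n) → u ⊕ ((⊖ u) ⊕ v) ≡ v
  ⊕-cancel-⊖ʳ u v = trans (sym (⊕-assoc u (⊖ u) v)) (trans (cong (_⊕ v) (⊕-inverseʳ u)) (⊕-identityˡ v))

  ⊕-interchange : ∀ {n} (a b c d : F^ q n) → (a ⊕ b) ⊕ (c ⊕ d) ≡ (a ⊕ c) ⊕ (b ⊕ d)
  ⊕-interchange a b c d = begin
    (a ⊕ b) ⊕ (c ⊕ d)  ≡⟨ ⊕-assoc a b (c ⊕ d) ⟩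
    a ⊕ (b ⊕ (c ⊕ d))  ≡⟨ cong (a ⊕_) (⊕-assoc b c d) ⟨
    a ⊕ ((b ⊕ c) ⊕ d)  ≡⟨ cong (λ x → a ⊕ (x ⊕ d)) (⊕-comm b c) ⟩
    a ⊕ ((c ⊕ b) ⊕ d)  ≡⟨ cong (a ⊕_) (⊕-assoc c b d) ⟩
    a ⊕ (c ⊕ (b ⊕ d))  ≡⟨ ⊕-assoc a c (b ⊕ d) ⟨
    (a ⊕ c) ⊕ (b ⊕ d)  ∎

  ·-distribˡ : ∀ {n} a (u v : F^ q n) → a · (u ⊕ v) ≡ a · u ⊕ a · v
  ·-distribˡ a []      []      = refl
  ·-distribˡ a (x ∷ u) (y ∷ v) = cong₂ _∷_ (⊠-distribˡ a x y) (·-distribˡ a u v)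

  ·-distribʳ : ∀ {n} a b (v : F^ q n) → (a ⊞ b) · v ≡ a · v ⊕ b · v
  ·-distribʳ a b []      = refl
  ·-distribʳ a b (x ∷ v) = cong₂ _∷_ (⊠-distribʳ x a b) (·-distribʳ a b v)

  ·-assoc : ∀ {n} a b (v : F^ q n) → (a ⊠ b) · v ≡ a · (b · v)
  ·-assoc a b []      = refl
  ·-assoc a b (x ∷ v) = cong₂ _∷_ (⊠-assoc a b x) (·-assoc a b v)

  ·-identityˡ : ∀ {n} (v : F^ q n) → 1F · v ≡ v
  ·-identityˡ v = trans (Vecₚ.map-cong ⊠-identityˡ v) (Vecₚ.map-id v)

  ·-zeroˡ : ∀ {n} (v : F^ q n) → 0F q · v ≡ 0V q
  ·-zeroˡ v = trans (Vecₚ.map-cong ⊠-zeroˡ v) (Vecₚ.map-const v (0F q))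

  ·-zeroʳ : ∀ {n} a → a · 0V q {n} ≡ 0V q
  ·-zeroʳ {n} a = trans (Vecₚ.map-replicate (a ⊠_) (0F q) n) (cong (Vec.replicate n) (⊠-zeroʳ a))

  lincomb-⊕ : ∀ {n d} (c c′ : F^ q d) (X : Vec (F^ q n) d) →
              lincomb q (c ⊕ c′) X ≡ lincomb q c X ⊕ lincomb q c′ X
  lincomb-⊕ []      []        []      = sym (⊕-identityˡ (0V q))
  lincomb-⊕ (a ∷ c) (a′ ∷ c′) (v ∷ X) = begin
    (a ⊞ a′) · v ⊕ lincomb q (c ⊕ c′) X                          ≡⟨ cong₂ _⊕_ (·-distribʳ a a′ v) (lincomb-⊕ c c′ X) ⟩
    (a · v ⊕ a′ · v) ⊕ (lincomb q c X ⊕ lincomb q c′ X)          ≡⟨ ⊕-interchange _ _ _ _ ⟩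
    (a · v ⊕ lincomb q c X) ⊕ (a′ · v ⊕ lincomb q c′ X)          ∎

  lincomb-· : ∀ {n d} a (c : F^ q d) (X : Vec (F^ q n) d) → lincomb q (a · c) X ≡ a · lincomb q c X
  lincomb-· a []      []      = sym (·-zeroʳ a)
  lincomb-· a (b ∷ c) (v ∷ X) = trans (cong₂ _⊕_ (·-assoc a b v) (lincomb-· a c X))
                                      (sym (·-distribˡ a (b · v) (lincomb q c X)))

  lincomb-0V : ∀ {n d} (X : Vec (F^ q n) d) → lincomb q (0V q) X ≡ 0V q
  lincomb-0V []      = refl
  lincomb-0V (v ∷ X) = trans (cong₂ _⊕_ (·-zeroˡ v) (lincomb-0V X)) (⊕-identityˡ (0V q))

  allF^-enumerates : ∀ n → Enumerates (allF^ q n)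
  allF^-enumerates = allVecs-enumerates (enumerates (Uniqueₚ.allFin⁺ q) ∈-allFin)

  allF^-length : ∀ n → length (allF^ q n) ≡ q ^ n
  allF^-length zero    = refl
  allF^-length (suc n) = trans (length-product (List.allFin q))
                               (cong₂ _*_ (Listₚ.length-tabulate {n = q} id) (allF^-length n))
    where
    length-product : ∀ xs → length (List.cartesianProductWith Vec._∷_ xs (allF^ q n)) ≡ length xs * length (allF^ q n)
    length-product []       = refl
    length-product (x ∷ xs) = trans (Listₚ.length-++ (List.map (x Vec.∷_) (allF^ q n)))
      (cong₂ _+_ (Listₚ.length-map (x Vec.∷_) (allF^ q n)) (length-product xs))

  ∑-allF^-1 : ∀ n → ∑ˡ (allF^ q n) (λ _ → 1ℚ) ≡ fromℕ (q ^ n)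
  ∑-allF^-1 n = trans (∑ˡ-length (allF^ q n)) (cong fromℕ (allF^-length n))

  -- Cardinalities of subsets, kernels and images

  card : ∀ {n} {V : Pred (F^ q n) 0ℓ} → Decidable V → ℕ
  card {n} V? = length (filter V? (allF^ q n))

  fromℕ-card : ∀ {n} {V : Pred (F^ q n) 0ℓ} (V? : Decidable V) →
               ∑ˡ (allF^ q n) (λ v → 𝟙 (V? v)) ≡ fromℕ (card V?)
  fromℕ-card {n} V? = begin
    ∑ˡ (allF^ q n) (λ v → 𝟙 (V? v))              ≡⟨ ∑ˡ-cong (allF^ q n) (λ v → ℚₚ.*-identityʳ (𝟙 (V? v))) ⟨
    ∑ˡ (allF^ q n) (λ v → 𝟙 (V? v) ℚ.* 1ℚ)       ≡⟨ ∑ˡ-filter V? (allF^ q n) (λ _ → 1ℚ) ⟨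
    ∑ˡ (filter V? (allF^ q n)) (λ _ → 1ℚ)        ≡⟨ ∑ˡ-length (filter V? (allF^ q n)) ⟩
    fromℕ (card V?)                              ∎

  card-cong : ∀ {n} {V W : Pred (F^ q n) 0ℓ} (V? : Decidable V) (W? : Decidable W) →
              (∀ v → V v → W v) → (∀ v → W v → V v) → card V? ≡ card W?
  card-cong {n} V? W? f g = fromℕ-injective (begin
    fromℕ (card V?)                    ≡⟨ fromℕ-card V? ⟨
    ∑ˡ (allF^ q n) (λ v → 𝟙 (V? v))    ≡⟨ ∑ˡ-cong (allF^ q n) (λ v → 𝟙-cong (V? v) (W? v) (f v) (g v)) ⟩
    ∑ˡ (allF^ q n) (λ v → 𝟙 (W? v))    ≡⟨ fromℕ-card W? ⟩
    fromℕ (card W?)                    ∎)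

  card≤ : ∀ {n} {V : Pred (F^ q n) 0ℓ} (V? : Decidable V) → card V? ≤ q ^ n
  card≤ {n} V? = ℕₚ.≤-trans (Listₚ.length-filter V? (allF^ q n)) (ℕₚ.≤-reflexive (allF^-length n))

  infix 4 _≟ⱽ_
  _≟ⱽ_ : ∀ {n} (u v : F^ q n) → Dec (u ≡ v)
  _≟ⱽ_ = _≟V_ q

  card-singleton : ∀ {n} {V : Pred (F^ q n) 0ℓ} (V? : Decidable V) {a} →
                   V a → (∀ {v} → V v → v ≡ a) → card V? ≡ 1
  card-singleton {n} V? Va only = fromℕ-injective (trans (sym (fromℕ-card V?))
    (trans (∑ˡ-𝟙≡1 V? (unique (allF^-enumerates n)) (complete (allF^-enumerates n) _) Va only) (sym fromℤ-1)))

  module _ {d n} (f : F^ q d → F^ q n) (f-⊕ : ∀ x y → f (x ⊕ y) ≡ f x ⊕ f y)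
           (image? : Decidable (λ y → ∃ λ x → f x ≡ y)) where

    private
      card-fibre : ∀ y → ∑ˡ (allF^ q d) (λ x → 𝟙 (f x ≟ⱽ y)) ≡ fromℕ (card (λ x → f x ≟ⱽ 0V q)) ℚ.* 𝟙 (image? y)
      card-fibre y with image? y
      ... | no ∄x = trans (trans (∑ˡ-cong (allF^ q d) (λ x → 𝟙-no (f x ≟ⱽ y) (λ eq → ∄x (x , eq))))
                                 (∑ˡ-zero (allF^ q d)))
                          (sym (ℚₚ.*-zeroʳ (fromℕ (card (λ x → f x ≟ⱽ 0V q)))))
      ... | yes (x₀ , refl) = begin
        ∑ˡ (allF^ q d) (λ x → 𝟙 (f x ≟ⱽ f x₀))         ≡⟨ ∑ˡ-reindex (allF^-enumerates d) (allF^-enumerates d)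
                                                             (x₀ ⊕_) ((⊖ x₀) ⊕_) (⊕-cancel-⊖ˡ x₀) (⊕-cancel-⊖ʳ x₀) _ ⟨
        ∑ˡ (allF^ q d) (λ x → 𝟙 (f (x₀ ⊕ x) ≟ⱽ f x₀))  ≡⟨ ∑ˡ-cong (allF^ q d) (λ x → 𝟙-cong (_ ≟ⱽ _) (_ ≟ⱽ _) (to x) (from x)) ⟩
        ∑ˡ (allF^ q d) (λ x → 𝟙 (f x ≟ⱽ 0V q))         ≡⟨ fromℕ-card (λ x → f x ≟ⱽ 0V q) ⟩
        fromℕ (card (λ x → f x ≟ⱽ 0V q))               ≡⟨ ℚₚ.*-identityʳ _ ⟨
        fromℕ (card (λ x → f x ≟ⱽ 0V q)) ℚ.* 1ℚ        ∎
        where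
        to : ∀ x → f (x₀ ⊕ x) ≡ f x₀ → f x ≡ 0V q
        to x eq = begin
          f x                             ≡⟨ ⊕-cancel-⊖ˡ (f x₀) (f x) ⟨
          (⊖ f x₀) ⊕ (f x₀ ⊕ f x)         ≡⟨ cong ((⊖ f x₀) ⊕_) (trans (sym (f-⊕ x₀ x)) eq) ⟩
          (⊖ f x₀) ⊕ f x₀                 ≡⟨ ⊕-inverseˡ (f x₀) ⟩
          0V q                            ∎
        from : ∀ x → f x ≡ 0V q → f (x₀ ⊕ x) ≡ f x₀
        from x eq = trans (f-⊕ x₀ x) (trans (cong (f x₀ ⊕_) eq) (⊕-identityʳ (f x₀)))

    -- Double counting of the pairs with `f x ≡ y`: every `x` lies in exactly one of them, and every
    -- `y` in the image lies in as many as the kernel has elements. Applied both to the coefficients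
    -- of a tuple and to matrices.
    card-kernel-image : card (λ x → f x ≟ⱽ 0V q) * card image? ≡ q ^ d
    card-kernel-image = fromℕ-injective (begin
      fromℕ (K * card image?)                                              ≡⟨ fromℕ-* K (card image?) ⟩
      fromℕ K ℚ.* fromℕ (card image?)                                      ≡⟨ cong (fromℕ K ℚ.*_) (fromℕ-card image?) ⟨
      fromℕ K ℚ.* ∑ˡ (allF^ q n) (λ y → 𝟙 (image? y))                      ≡⟨ ∑ˡ-*ˡ (allF^ q n) (fromℕ K) _ ⟨
      ∑ˡ (allF^ q n) (λ y → fromℕ K ℚ.* 𝟙 (image? y))                      ≡⟨ ∑ˡ-cong (allF^ q n) card-fibre ⟨
      ∑ˡ (allF^ q n) (λ y → ∑ˡ (allF^ q d) (λ x → 𝟙 (f x ≟ⱽ y)))           ≡⟨ ∑ˡ-comm (allF^ q n) (allF^ q d) _ ⟩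
      ∑ˡ (allF^ q d) (λ x → ∑ˡ (allF^ q n) (λ y → 𝟙 (f x ≟ⱽ y)))           ≡⟨ ∑ˡ-cong (allF^ q d) (λ x → ∑ˡ-𝟙≡1 (f x ≟ⱽ_)
                                                                                (unique (allF^-enumerates n))
                                                                                (complete (allF^-enumerates n) (f x)) refl sym) ⟩
      ∑ˡ (allF^ q d) (λ x → 1ℚ)                                            ≡⟨ ∑-allF^-1 d ⟩
      fromℕ (q ^ d)                                                        ∎)
      where K = card (λ x → f x ≟ⱽ 0V q)


-- Bases, dimension and spans

module Dimension (q : ℕ) .{{_ : NonTrivial q}} (q-prime : Prime q) where

  open import Data.Nat using (_+_; _*_)

  open Field q q-prime

  q^-injective : ∀ {m n} → q ^ m ≡ q ^ n → m ≡ n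
  q^-injective {m} {n} eq = ℕₚ.≤-antisym (≤-of eq) (≤-of (sym eq))
    where
    ≤-of : ∀ {m n} → q ^ m ≡ q ^ n → m ≤ n
    ≤-of eq = ℕₚ.≮⇒≥ (λ n<m → ℕₚ.<⇒≢ (ℕₚ.^-monoʳ-< q (ℕ.nonTrivial⇒n>1 q) n<m) (sym eq))

  record IsSubspace {n} (V : Pred (F^ q n) 0ℓ) : Set where
    field
      0V-closed : V (0V q)
      ⊕-closed  : ∀ {u v} → V u → V v → V (u ⊕ v)
      ·-closed  : ∀ a {v} → V v → V (a · v)

  open IsSubspace

  Span : ∀ {n d} → Vec (F^ q n) d → Pred (F^ q n) 0ℓ
  Span X v = ∃ λ c → lincomb q c X ≡ v

  span? : ∀ {n d} (X : Vec (F^ q n) d) → Decidable (Span X)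
  span? X v = ∃? (allF^-complete q) (λ c → lincomb q c X ≟ⱽ v)

  Span-subspace : ∀ {n d} (X : Vec (F^ q n) d) → IsSubspace (Span X)
  Span-subspace X .0V-closed = 0V q , lincomb-0V X
  Span-subspace X .⊕-closed (c , refl) (c′ , refl) = c ⊕ c′ , lincomb-⊕ c c′ X
  Span-subspace X .·-closed a (c , refl) = a · c , lincomb-· a c X

  Span-∷ : ∀ {n d} (v : F^ q n) (X : Vec (F^ q n) d) {u} → Span X u → Span (v ∷ X) u
  Span-∷ v X {u} (c , eq) = 0F q ∷ c , trans (cong₂ _⊕_ (·-zeroˡ v) eq) (⊕-identityˡ u)

  lincomb-closed : ∀ {n d} {V : Pred (F^ q n) 0ℓ} → IsSubspace V →
                   (c : F^ q d) {X : Vec (F^ q n) d} → All V X → V (lincomb q c X)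
  lincomb-closed V-sub []      []       = 0V-closed V-sub
  lincomb-closed V-sub (a ∷ c) (v∈ ∷ X⊆) = ⊕-closed V-sub (·-closed V-sub a v∈) (lincomb-closed V-sub c X⊆)

  Span-⊆ : ∀ {n d} {V : Pred (F^ q n) 0ℓ} → IsSubspace V →
           {X : Vec (F^ q n) d} → All V X → ∀ {v} → Span X v → V v
  Span-⊆ V-sub X⊆ (c , refl) = lincomb-closed V-sub c X⊆

  -- A nonzero `a` could be inverted, and the relation would then express `v` as a combination of
  -- `X`.
  lincomb-∷≡0 : ∀ {n d} {v : F^ q n} {X : Vec (F^ q n) d} → ¬ Span X v → ∀ a c →
                lincomb q (a ∷ c) (v ∷ X) ≡ 0V q → a ≡ 0F q × lincomb q c X ≡ 0V q
  lincomb-∷≡0 {v = v} {X} v∉ a c eq with a Finₚ.≟ 0F q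
  ... | yes refl = refl , trans (sym (⊕-identityˡ _)) (trans (cong (_⊕ lincomb q c X) (sym (·-zeroˡ v))) eq)
  ... | no a≢0 with ⊠-inverse a a≢0
  ...   | b , ba≡1 = contradiction
          (b · (⊖ c) , (begin
            lincomb q (b · (⊖ c)) X            ≡⟨ lincomb-· b (⊖ c) X ⟩
            b · lincomb q (⊖ c) X              ≡⟨ cong (b ·_) a·v ⟨
            b · (a · v)                         ≡⟨ ·-assoc b a v ⟨
            (b ⊠ a) · v                         ≡⟨ cong (_· v) ba≡1 ⟩
            1F · v                              ≡⟨ ·-identityˡ v ⟩
            v                                   ∎)) v∉
    where
    a·v : a · v ≡ lincomb q (⊖ c) X
    a·v = begin
      a · v                                                      ≡⟨ ⊕-identityʳ _ ⟨
      a · v ⊕ 0V q                                               ≡⟨ cong (a · v ⊕_) (lincomb-0V X) ⟨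
      a · v ⊕ lincomb q (0V q) X                                 ≡⟨ cong (λ x → a · v ⊕ lincomb q x X) (⊕-inverseʳ c) ⟨
      a · v ⊕ lincomb q (c ⊕ (⊖ c)) X                            ≡⟨ cong (a · v ⊕_) (lincomb-⊕ c (⊖ c) X) ⟩
      a · v ⊕ (lincomb q c X ⊕ lincomb q (⊖ c) X)                ≡⟨ ⊕-assoc _ _ _ ⟨
      (a · v ⊕ lincomb q c X) ⊕ lincomb q (⊖ c) X                ≡⟨ cong (_⊕ lincomb q (⊖ c) X) eq ⟩
      0V q ⊕ lincomb q (⊖ c) X                                   ≡⟨ ⊕-identityˡ _ ⟩
      lincomb q (⊖ c) X                                          ∎

  card-kernel-span : ∀ {n d} (X : Vec (F^ q n) d) →
                     card (λ c → lincomb q c X ≟ⱽ 0V q) * card (span? X) ≡ q ^ d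
  card-kernel-span X = card-kernel-image (λ c → lincomb q c X) (λ c c′ → lincomb-⊕ c c′ X) (span? X)

  -- Independence says that the coefficient map has the zero vector as its whole kernel.
  independent-card : ∀ {n d} (X : Vec (F^ q n) d) → LinIndep q X → card (span? X) ≡ q ^ d
  independent-card {d = d} X indep = begin
    card (span? X)                                          ≡⟨ ℕₚ.*-identityˡ _ ⟨
    1 * card (span? X)                                      ≡⟨ cong (_* card (span? X)) (card-singleton
                                                                 (λ c → lincomb q c X ≟ⱽ 0V q) (lincomb-0V X) (indep _)) ⟨
    card (λ c → lincomb q c X ≟ⱽ 0V q) * card (span? X)     ≡⟨ card-kernel-span X ⟩
    q ^ d                                                   ∎

  -- A comparison of cardinalities in place of Steinitz exchange: the span has q^d elements inside a
  -- space of q^n.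
  independent-size≤ : ∀ {n d} (X : Vec (F^ q n) d) → LinIndep q X → d ≤ n
  independent-size≤ {n} {d} X indep = ℕₚ.≮⇒≥ (λ n<d → ℕₚ.<⇒≱ (ℕₚ.^-monoʳ-< q (ℕ.nonTrivial⇒n>1 q) n<d)
    (ℕₚ.≤-trans (ℕₚ.≤-reflexive (sym (independent-card X indep))) (card≤ (span? X))))

  module _ {n} {V : Pred (F^ q n) 0ℓ} (V-sub : IsSubspace V) (V? : Decidable V) where

    basis-card : ∀ {d} {X : Vec (F^ q n) d} → IsBasis q V X → card V? ≡ q ^ d
    basis-card {X = X} (X⊆ , indep , spans) =
      trans (card-cong V? (span? X) spans (λ v → Span-⊆ V-sub X⊆)) (independent-card X indep)

    -- Each round either finds a vector of `V` outside the span and appends it, or stops with a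
    -- spanning tuple. The invariant `n < d + fuel` makes exhausted fuel contradict
    -- `independent-size≤`.
    extend-to-basis : ∀ fuel {d} (X : Vec (F^ q n) d) → All V X → LinIndep q X → n < d + fuel →
                      ∃ λ d′ → ∃ λ (Y : Vec (F^ q n) d′) → IsBasis q V Y
    extend-to-basis zero {d} X X⊆ indep n<d =
      contradiction (independent-size≤ X indep) (ℕₚ.<⇒≱ (subst (n <_) (ℕₚ.+-identityʳ d) n<d))
    extend-to-basis (suc fuel) {d} X X⊆ indep n<d
      with ∃? (allF^-complete q) (λ v → V? v ×-dec ¬? (span? X v))
    ... | no ∄v = d , X , X⊆ , indep ,
                  λ v v∈ → decidable-stable (span? X v) (λ v∉ → ∄v (v , v∈ , v∉))
    ... | yes (v , v∈ , v∉) =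
      extend-to-basis fuel (v ∷ X) (v∈ ∷ X⊆) indep′ (subst (n <_) (ℕₚ.+-suc d fuel) n<d)
      where
      indep′ : LinIndep q (v ∷ X)
      indep′ (a ∷ c) eq with lincomb-∷≡0 v∉ a c eq
      ... | refl , eq′ = cong (0F q ∷_) (indep c eq′)

    basis-exists : ∃ λ d → ∃ λ (X : Vec (F^ q n) d) → IsBasis q V X
    basis-exists = extend-to-basis (suc n) [] [] (λ { [] _ → refl }) ℕₚ.≤-refl

    -- Going downwards, the search cannot pass `d`. It might a priori stop earlier, but it then
    -- stops at the size of some basis, and all that is claimed is that such a basis exists;
    -- uniqueness of the size comes from cardinalities.
    searchDim-basis : ∀ m {d} {X : Vec (F^ q n) d} → IsBasis q V X → d ≤ m →
                      ∃ λ (Y : Vec (F^ q n) (searchDim q V? m)) → IsBasis q V Y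
    searchDim-basis zero    {X = X} basis ℕ.z≤n = X , basis
    searchDim-basis (suc m) {X = X} basis d≤ with hasBasis? q V? (suc m)
    ... | yes found = found
    ... | no  none with ℕₚ.m≤n⇒m<n∨m≡n d≤
    ...   | inj₁ d<     = searchDim-basis m basis (ℕ.s≤s⁻¹ d<)
    ...   | inj₂ refl   = contradiction (X , basis) none

    card-dim : card V? ≡ q ^ dim q V?
    card-dim with basis-exists
    ... | d , X , basis@(_ , indep , _) =
      basis-card (proj₂ (searchDim-basis n basis (independent-size≤ X indep)))

    -- With `card-dim`, this determines a dimension by counting, whichever basis the search in `dim`
    -- has met.
    dim-unique : ∀ {d} → card V? ≡ q ^ d → dim q V? ≡ d
    dim-unique eq = q^-injective (trans (sym card-dim) eq)

  searchDim≤ : ∀ {n} {V : Pred (F^ q n) 0ℓ} (V? : Decidable V) m → searchDim q V? m ≤ m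
  searchDim≤ V? zero    = ℕ.z≤n
  searchDim≤ V? (suc m) with hasBasis? q V? (suc m)
  ... | yes _ = ℕₚ.≤-refl
  ... | no  _ = ℕₚ.m≤n⇒m≤1+n (searchDim≤ V? m)

  dim≤ : ∀ {n} {V : Pred (F^ q n) 0ℓ} (V? : Decidable V) → dim q V? ≤ n
  dim≤ {n} V? = searchDim≤ V? n

  dim-cong : ∀ {n} {V W : Pred (F^ q n) 0ℓ} (V? : Decidable V) (W? : Decidable W) →
             IsSubspace V → IsSubspace W → (∀ v → V v → W v) → (∀ v → W v → V v) → dim q V? ≡ dim q W?
  dim-cong V? W? V-sub W-sub V⊆W W⊆V =
    dim-unique V-sub V? (trans (card-cong V? W? V⊆W W⊆V) (card-dim W-sub W?))

  spanDim : ∀ {n d} → Vec (F^ q n) d → ℕ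
  spanDim X = dim q (span? X)

  card-span : ∀ {n d} (X : Vec (F^ q n) d) → card (span? X) ≡ q ^ spanDim X
  card-span X = card-dim (Span-subspace X) (span? X)

  spanDim-∷-∈ : ∀ {n d} (v : F^ q n) (X : Vec (F^ q n) d) → Span X v → spanDim (v ∷ X) ≡ spanDim X
  spanDim-∷-∈ v X v∈ = dim-cong (span? (v ∷ X)) (span? X) (Span-subspace (v ∷ X)) (Span-subspace X)
    (λ { _ (a ∷ c , refl) → ⊕-closed (Span-subspace X) (·-closed (Span-subspace X) a v∈) (c , refl) })
    (λ _ → Span-∷ v X)

  -- Since `v` must get coefficient 0 in any relation, `X` and `v ∷ X` have equally many relations,
  -- namely `K`. There are `q` times as many coefficient vectors for `v ∷ X`, so by
  -- `card-kernel-span` its span is `q` times as large.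
  spanDim-∷-∉ : ∀ {n d} (v : F^ q n) (X : Vec (F^ q n) d) → ¬ Span X v → spanDim (v ∷ X) ≡ suc (spanDim X)
  spanDim-∷-∉ {d = d} v X v∉ = dim-unique (Span-subspace (v ∷ X)) (span? (v ∷ X))
    (ℕₚ.*-cancelˡ-≡ _ _ K {{K-nonZero}} (begin
      K * card (span? (v ∷ X))                                                ≡⟨ cong (_* card (span? (v ∷ X))) same-kernel ⟨
      card (λ c → lincomb q c (v ∷ X) ≟ⱽ 0V q) * card (span? (v ∷ X))         ≡⟨ card-kernel-span (v ∷ X) ⟩
      q * q ^ d                                                               ≡⟨ cong (q *_) (card-kernel-span X) ⟨
      q * (K * card (span? X))                                                ≡⟨ cong (λ x → q * (K * x)) (card-span X) ⟩
      q * (K * q ^ spanDim X)                                                 ≡⟨ ℕₚ.*-comm q _ ⟩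
      K * q ^ spanDim X * q                                                   ≡⟨ ℕₚ.*-assoc K _ q ⟩
      K * (q ^ spanDim X * q)                                                 ≡⟨ cong (K *_) (ℕₚ.*-comm _ q) ⟩
      K * (q * q ^ spanDim X)                                                 ∎))
    where
    K = card (λ c → lincomb q c X ≟ⱽ 0V q)

    K-nonZero : NonZero K
    K-nonZero = ℕ.≢-nonZero (λ K≡0 → ℕ.≢-nonZero⁻¹ (q ^ d) {{ℕₚ.m^n≢0 q d}}
      (trans (sym (card-kernel-span X)) (cong (_* card (span? X)) K≡0)))

    Σ₀ : ∀ c → ∑ˡ (List.allFin q) (λ a → 𝟙 (lincomb q (a ∷ c) (v ∷ X) ≟ⱽ 0V q)) ≡ 𝟙 (lincomb q c X ≟ⱽ 0V q)
    Σ₀ c = begin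
      ∑ˡ (List.allFin q) (λ a → 𝟙 (lincomb q (a ∷ c) (v ∷ X) ≟ⱽ 0V q))
        ≡⟨ ∑ˡ-cong (List.allFin q) (λ a → 𝟙-cong (lincomb q (a ∷ c) (v ∷ X) ≟ⱽ 0V q)
             ((a Finₚ.≟ 0F q) ×-dec (lincomb q c X ≟ⱽ 0V q)) (lincomb-∷≡0 v∉ a c)
             (λ (a≡0 , eq) → trans (cong₂ _⊕_ (trans (cong (_· v) a≡0) (·-zeroˡ v)) eq) (⊕-identityˡ _))) ⟩
      ∑ˡ (List.allFin q) (λ a → 𝟙 ((a Finₚ.≟ 0F q) ×-dec (lincomb q c X ≟ⱽ 0V q)))
        ≡⟨ ∑ˡ-cong (List.allFin q) (λ a → 𝟙-× (a Finₚ.≟ 0F q) (lincomb q c X ≟ⱽ 0V q)) ⟩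
      ∑ˡ (List.allFin q) (λ a → 𝟙 (a Finₚ.≟ 0F q) ℚ.* 𝟙 (lincomb q c X ≟ⱽ 0V q))
        ≡⟨ ∑ˡ-*ʳ (List.allFin q) (λ a → 𝟙 (a Finₚ.≟ 0F q)) _ ⟩
      ∑ˡ (List.allFin q) (λ a → 𝟙 (a Finₚ.≟ 0F q)) ℚ.* 𝟙 (lincomb q c X ≟ⱽ 0V q)
        ≡⟨ cong (ℚ._* 𝟙 (lincomb q c X ≟ⱽ 0V q)) (∑ˡ-𝟙≡1 (Finₚ._≟ 0F q) (Uniqueₚ.allFin⁺ q) (∈-allFin (0F q)) refl id) ⟩
      1ℚ ℚ.* 𝟙 (lincomb q c X ≟ⱽ 0V q)
        ≡⟨ ℚₚ.*-identityˡ _ ⟩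
      𝟙 (lincomb q c X ≟ⱽ 0V q) ∎

    same-kernel : card (λ c → lincomb q c (v ∷ X) ≟ⱽ 0V q) ≡ K
    same-kernel = fromℕ-injective (begin
      fromℕ (card (λ c → lincomb q c (v ∷ X) ≟ⱽ 0V q))
        ≡⟨ fromℕ-card (λ c → lincomb q c (v ∷ X) ≟ⱽ 0V q) ⟨
      ∑ˡ (allF^ q (suc d)) (λ c → 𝟙 (lincomb q c (v ∷ X) ≟ⱽ 0V q))
        ≡⟨ ∑ˡ-allVecs-suc (List.allFin q) d _ ⟩
      ∑ˡ (List.allFin q) (λ a → ∑ˡ (allF^ q d) (λ c → 𝟙 (lincomb q (a ∷ c) (v ∷ X) ≟ⱽ 0V q)))
        ≡⟨ ∑ˡ-comm (List.allFin q) (allF^ q d) _ ⟩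
      ∑ˡ (allF^ q d) (λ c → ∑ˡ (List.allFin q) (λ a → 𝟙 (lincomb q (a ∷ c) (v ∷ X) ≟ⱽ 0V q)))
        ≡⟨ ∑ˡ-cong (allF^ q d) Σ₀ ⟩
      ∑ˡ (allF^ q d) (λ c → 𝟙 (lincomb q c X ≟ⱽ 0V q))
        ≡⟨ fromℕ-card (λ c → lincomb q c X ≟ⱽ 0V q) ⟩
      fromℕ K ∎)

-- Counting tuples by the dimension of their span

module TupleCount (q : ℕ) .{{_ : NonTrivial q}} (q-prime : Prime q) where

  open import Data.Rational using (_+_; _*_; _-_)

  open Field q q-prime
  open Dimension q q-prime

  Q : ℕ → ℚ
  Q j = fromℕ (q ^ j)

  Q-zero : Q 0 ≡ 1ℚ
  Q-zero = fromℤ-1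

  Q-suc : ∀ j → Q (suc j) ≡ fromℕ q * Q j
  Q-suc j = fromℕ-* q (q ^ j)

  -- The product of the q^s - q^j for j < r, a q-analogue of the falling factorial: it counts the
  -- linearly independent `r`-tuples in an `s`-dimensional space. `falling r r`, the order of GL_r,
  -- is the denominator of P.
  falling : ℕ → ℕ → ℚ
  falling s zero    = 1ℚ
  falling s (suc r) = falling s r * (Q s - Q r)

  falling-zero : ∀ r → falling 0 (suc r) ≡ 0ℚ
  falling-zero zero    = trans (ℚₚ.*-identityˡ _) (ℚₚ.+-inverseʳ (Q 0))
  falling-zero (suc r) = trans (cong (_* (Q 0 - Q (suc r))) (falling-zero r)) (ℚₚ.*-zeroˡ (Q 0 - Q (suc r)))

  -- The definition splits off the last factor, this the first, `Q (suc s) - 1ℚ`. Each of the other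
  -- `r` factors has the form q^(s+1) - q^(j+1) and yields one factor `q`; together they make `Q r`.
  falling-suc : ∀ s r → falling (suc s) (suc r) ≡ (Q (suc s) - 1ℚ) * Q r * falling s r
  falling-suc s zero    = trans (cong (λ x → 1ℚ * (Q (suc s) - x)) Q-zero)
    (trans (solve 1 (λ a → con 1ℚ :* (a :- con 1ℚ) := (a :- con 1ℚ) :* con 1ℚ :* con 1ℚ) refl (Q (suc s)))
           (cong (λ x → (Q (suc s) - 1ℚ) * x * 1ℚ) (sym Q-zero)))
  falling-suc s (suc r) = begin
    falling (suc s) (suc r) * (Q (suc s) - Q (suc r))
      ≡⟨ cong₂ _*_ (falling-suc s r) (cong₂ _-_ (Q-suc s) (Q-suc r)) ⟩
    (Q (suc s) - 1ℚ) * Q r * falling s r * (fromℕ q * Q s - fromℕ q * Q r)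
      ≡⟨ solve 5 (λ z a f p b → (z :* a :* f) :* (p :* b :- p :* a) := z :* (p :* a) :* (f :* (b :- a))) refl
           (Q (suc s) - 1ℚ) (Q r) (falling s r) (fromℕ q) (Q s) ⟩
    (Q (suc s) - 1ℚ) * (fromℕ q * Q r) * falling s (suc r)
      ≡⟨ cong (λ x → (Q (suc s) - 1ℚ) * x * falling s (suc r)) (Q-suc r) ⟨
    (Q (suc s) - 1ℚ) * Q (suc r) * falling s (suc r) ∎

  falling-product : ∀ s r → falling s r ≡ product {r} (λ j → Q s - Q (toℕ j))
  falling-product s zero    = refl
  falling-product s (suc r) = sym (begin
    product {suc r} (λ j → Q s - Q (toℕ j))
      ≡⟨ Product.sum-init-last {r} (λ j → Q s - Q (toℕ j)) ⟩
    product {r} (λ j → Q s - Q (toℕ (Fin.inject₁ j))) * (Q s - Q (toℕ (Fin.fromℕ r)))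
      ≡⟨ cong₂ _*_ (Product.sum-cong-≗ {r} (λ j → cong (λ i → Q s - Q i) (Finₚ.toℕ-inject₁ j)))
                   (cong (λ i → Q s - Q i) (Finₚ.toℕ-fromℕ r)) ⟩
    product {r} (λ j → Q s - Q (toℕ j)) * (Q s - Q r)
      ≡⟨ cong (_* (Q s - Q r)) (falling-product s r) ⟨
    falling s r * (Q s - Q r) ∎)

  module _ {n} {V : Pred (F^ q n) 0ℓ} (V-sub : IsSubspace V) (V? : Decidable V) where

    private
      k : ℕ
      k = dim q V?

    all? : ∀ {s} (X : Vec (F^ q n) s) → Dec (All V X)
    all? X = All.all? V? X

    rankCount : ℕ → ℕ → ℚ
    rankCount s r = ∑ˡ (allMats q s n) (λ X → 𝟙 (all? X) * 𝟙 (spanDim X ℕₚ.≟ r))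

    𝟙-all?-∷ : ∀ {s} v (X : Vec (F^ q n) s) → 𝟙 (all? (v ∷ X)) ≡ 𝟙 (V? v) * 𝟙 (all? X)
    𝟙-all?-∷ v X = trans (𝟙-cong (all? (v ∷ X)) (V? v ×-dec all? X) All.uncons (λ (p , ps) → p ∷ ps))
                         (𝟙-× (V? v) (all? X))

    ∑-V : ∑ˡ (allF^ q n) (λ v → 𝟙 (V? v)) ≡ Q k
    ∑-V = trans (fromℕ-card V?) (cong fromℕ (card-dim V-sub V?))

    tuple-count : ∀ s → ∑ˡ (allMats q s n) (λ X → 𝟙 (all? X)) ≡ Q (k ℕ.* s)
    tuple-count zero    = trans (ℚₚ.+-identityʳ _)
      (trans (𝟙-yes (all? []) []) (trans (sym Q-zero) (cong Q (sym (ℕₚ.*-zeroʳ k)))))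
    tuple-count (suc s) = begin
      ∑ˡ (allMats q (suc s) n) (λ X → 𝟙 (all? X))
        ≡⟨ ∑ˡ-allVecs-suc (allF^ q n) s _ ⟩
      ∑ˡ (allF^ q n) (λ v → ∑ˡ (allMats q s n) (λ X → 𝟙 (all? (v ∷ X))))
        ≡⟨ ∑ˡ-cong (allF^ q n) (λ v → trans (∑ˡ-cong (allMats q s n) (𝟙-all?-∷ v)) (∑ˡ-*ˡ (allMats q s n) (𝟙 (V? v)) _)) ⟩
      ∑ˡ (allF^ q n) (λ v → 𝟙 (V? v) * ∑ˡ (allMats q s n) (λ X → 𝟙 (all? X)))
        ≡⟨ ∑ˡ-*ʳ (allF^ q n) (λ v → 𝟙 (V? v)) _ ⟩
      ∑ˡ (allF^ q n) (λ v → 𝟙 (V? v)) * ∑ˡ (allMats q s n) (λ X → 𝟙 (all? X))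
        ≡⟨ cong₂ _*_ ∑-V (tuple-count s) ⟩
      Q k * Q (k ℕ.* s)
        ≡⟨ fromℕ-* (q ^ k) (q ^ (k ℕ.* s)) ⟨
      fromℕ (q ^ k ℕ.* q ^ (k ℕ.* s))
        ≡⟨ cong fromℕ (trans (sym (ℕₚ.^-distribˡ-+-* q k (k ℕ.* s))) (cong (q ^_) (sym (ℕₚ.*-suc k s)))) ⟩
      Q (k ℕ.* suc s) ∎

    ∑-extensions : ∀ {s} (X : Vec (F^ q n) s) r → All V X →
      ∑ˡ (allF^ q n) (λ v → 𝟙 (V? v) * 𝟙 (spanDim (v ∷ X) ℕₚ.≟ r)) ≡
      𝟙 (spanDim X ℕₚ.≟ r) * Q (spanDim X) + 𝟙 (suc (spanDim X) ℕₚ.≟ r) * (Q k - Q (spanDim X))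
    ∑-extensions X r X⊆ = begin
      ∑ˡ (allF^ q n) (λ v → 𝟙 (V? v) * 𝟙 (spanDim (v ∷ X) ℕₚ.≟ r))
        ≡⟨ ∑ˡ-cong (allF^ q n) pointwise ⟩
      ∑ˡ (allF^ q n) (λ v → 𝟙 (span? X v) * (x - y) + 𝟙 (V? v) * y)
        ≡⟨ ∑ˡ-+ (allF^ q n) _ _ ⟩
      ∑ˡ (allF^ q n) (λ v → 𝟙 (span? X v) * (x - y)) + ∑ˡ (allF^ q n) (λ v → 𝟙 (V? v) * y)
        ≡⟨ cong₂ _+_ (∑ˡ-*ʳ (allF^ q n) (λ v → 𝟙 (span? X v)) (x - y)) (∑ˡ-*ʳ (allF^ q n) (λ v → 𝟙 (V? v)) y) ⟩
      ∑ˡ (allF^ q n) (λ v → 𝟙 (span? X v)) * (x - y) + ∑ˡ (allF^ q n) (λ v → 𝟙 (V? v)) * y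
        ≡⟨ cong₂ (λ a b → a * (x - y) + b * y) (trans (fromℕ-card (span? X)) (cong fromℕ (card-span X))) ∑-V ⟩
      Q (spanDim X) * (x - y) + Q k * y
        ≡⟨ solve 4 (λ a b x y → a :* (x :- y) :+ b :* y := x :* a :+ y :* (b :- a)) refl (Q (spanDim X)) (Q k) x y ⟩
      x * Q (spanDim X) + y * (Q k - Q (spanDim X)) ∎
      where
      x = 𝟙 (spanDim X ℕₚ.≟ r)
      y = 𝟙 (suc (spanDim X) ℕₚ.≟ r)
      -- The span lies in `V`, so the vectors of `V` outside it have indicator
      -- `𝟙 (V? v) - 𝟙 (span? X v)`. Collecting the two indicators leaves only the cardinalities of
      -- the span and of `V` to be inserted.
      pointwise : ∀ v → 𝟙 (V? v) * 𝟙 (spanDim (v ∷ X) ℕₚ.≟ r) ≡ 𝟙 (span? X v) * (x - y) + 𝟙 (V? v) * y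
      pointwise v = by-cases (span? X v)
        where
        by-cases : Dec (Span X v) → 𝟙 (V? v) * 𝟙 (spanDim (v ∷ X) ℕₚ.≟ r) ≡ 𝟙 (span? X v) * (x - y) + 𝟙 (V? v) * y
        by-cases (yes v∈) = begin
          𝟙 (V? v) * 𝟙 (spanDim (v ∷ X) ℕₚ.≟ r)   ≡⟨ cong₂ (λ a i → a * 𝟙 (i ℕₚ.≟ r)) V?v (spanDim-∷-∈ v X v∈) ⟩
          1ℚ * x                                   ≡⟨ solve 2 (λ x y → con 1ℚ :* x := con 1ℚ :* (x :- y) :+ con 1ℚ :* y) refl x y ⟩
          1ℚ * (x - y) + 1ℚ * y                    ≡⟨ cong₂ (λ a b → a * (x - y) + b * y) (𝟙-yes (span? X v) v∈) V?v ⟨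
          𝟙 (span? X v) * (x - y) + 𝟙 (V? v) * y   ∎
          where
          V?v = 𝟙-yes (V? v) (Span-⊆ V-sub X⊆ v∈)
        by-cases (no v∉) = begin
          𝟙 (V? v) * 𝟙 (spanDim (v ∷ X) ℕₚ.≟ r)   ≡⟨ cong (λ i → 𝟙 (V? v) * 𝟙 (i ℕₚ.≟ r)) (spanDim-∷-∉ v X v∉) ⟩
          𝟙 (V? v) * y                             ≡⟨ solve 3 (λ a x y → a :* y := con 0ℚ :* (x :- y) :+ a :* y) refl (𝟙 (V? v)) x y ⟩
          0ℚ * (x - y) + 𝟙 (V? v) * y              ≡⟨ cong (λ a → a * (x - y) + 𝟙 (V? v) * y) (𝟙-no (span? X v) v∉) ⟨
          𝟙 (span? X v) * (x - y) + 𝟙 (V? v) * y   ∎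

    -- The sums are exchanged so that the tuple `X` is fixed before the appended vector. The
    -- contribution of vectors that raise the dimension stays a sum, because it vanishes for `r = 0`
    -- and becomes a multiple of a smaller count for a successor.
    rankCount-split : ∀ s r → rankCount (suc s) r ≡
      Q r * rankCount s r +
      ∑ˡ (allMats q s n) (λ X → 𝟙 (all? X) * (𝟙 (suc (spanDim X) ℕₚ.≟ r) * (Q k - Q (spanDim X))))
    rankCount-split s r = begin
      ∑ˡ (allMats q (suc s) n) (λ X → 𝟙 (all? X) * 𝟙 (spanDim X ℕₚ.≟ r))
        ≡⟨ ∑ˡ-allVecs-suc (allF^ q n) s _ ⟩
      ∑ˡ (allF^ q n) (λ v → ∑ˡ (allMats q s n) (λ X → 𝟙 (all? (v ∷ X)) * 𝟙 (spanDim (v ∷ X) ℕₚ.≟ r)))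
        ≡⟨ ∑ˡ-comm (allF^ q n) (allMats q s n) _ ⟩
      ∑ˡ (allMats q s n) (λ X → ∑ˡ (allF^ q n) (λ v → 𝟙 (all? (v ∷ X)) * 𝟙 (spanDim (v ∷ X) ℕₚ.≟ r)))
        ≡⟨ ∑ˡ-cong (allMats q s n) inner ⟩
      ∑ˡ (allMats q s n) (λ X → Q r * (𝟙 (all? X) * 𝟙 (spanDim X ℕₚ.≟ r)) + rest X)
        ≡⟨ ∑ˡ-+ (allMats q s n) _ rest ⟩
      ∑ˡ (allMats q s n) (λ X → Q r * (𝟙 (all? X) * 𝟙 (spanDim X ℕₚ.≟ r))) + ∑ˡ (allMats q s n) rest
        ≡⟨ cong (_+ ∑ˡ (allMats q s n) rest) (∑ˡ-*ˡ (allMats q s n) (Q r) _) ⟩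
      Q r * rankCount s r + ∑ˡ (allMats q s n) rest ∎
      where
      rest : Vec (F^ q n) s → ℚ
      rest X = 𝟙 (all? X) * (𝟙 (suc (spanDim X) ℕₚ.≟ r) * (Q k - Q (spanDim X)))
      inner : ∀ X → ∑ˡ (allF^ q n) (λ v → 𝟙 (all? (v ∷ X)) * 𝟙 (spanDim (v ∷ X) ℕₚ.≟ r)) ≡
                    Q r * (𝟙 (all? X) * 𝟙 (spanDim X ℕₚ.≟ r)) + rest X
      inner X = begin
        ∑ˡ (allF^ q n) (λ v → 𝟙 (all? (v ∷ X)) * 𝟙 (spanDim (v ∷ X) ℕₚ.≟ r))
          ≡⟨ ∑ˡ-cong (allF^ q n) (λ v → trans (cong (_* 𝟙 (spanDim (v ∷ X) ℕₚ.≟ r)) (𝟙-all?-∷ v X))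
               (solve 3 (λ a b c → a :* b :* c := b :* (a :* c)) refl (𝟙 (V? v)) (𝟙 (all? X)) _)) ⟩
        ∑ˡ (allF^ q n) (λ v → 𝟙 (all? X) * (𝟙 (V? v) * 𝟙 (spanDim (v ∷ X) ℕₚ.≟ r)))
          ≡⟨ ∑ˡ-*ˡ (allF^ q n) (𝟙 (all? X)) _ ⟩
        𝟙 (all? X) * ∑ˡ (allF^ q n) (λ v → 𝟙 (V? v) * 𝟙 (spanDim (v ∷ X) ℕₚ.≟ r))
          ≡⟨ 𝟙-subst (all? X) (∑-extensions X r) ⟩
        𝟙 (all? X) * (𝟙 (spanDim X ℕₚ.≟ r) * Q (spanDim X) + b)
          ≡⟨ cong (λ a → 𝟙 (all? X) * (a + b)) (𝟙-subst (spanDim X ℕₚ.≟ r) (cong Q)) ⟩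
        𝟙 (all? X) * (𝟙 (spanDim X ℕₚ.≟ r) * Q r + b)
          ≡⟨ solve 4 (λ a x b c → a :* (x :* c :+ b) := c :* (a :* x) :+ a :* b) refl
               (𝟙 (all? X)) (𝟙 (spanDim X ℕₚ.≟ r)) b (Q r) ⟩
        Q r * (𝟙 (all? X) * 𝟙 (spanDim X ℕₚ.≟ r)) + 𝟙 (all? X) * b ∎
        where
        b = 𝟙 (suc (spanDim X) ℕₚ.≟ r) * (Q k - Q (spanDim X))

    rankCount-suc-zero : ∀ s → rankCount (suc s) 0 ≡ rankCount s 0
    rankCount-suc-zero s = begin
      rankCount (suc s) 0
        ≡⟨ rankCount-split s 0 ⟩
      Q 0 * rankCount s 0 + ∑ˡ (allMats q s n) (λ X → 𝟙 (all? X) * (𝟙 (suc (spanDim X) ℕₚ.≟ 0) * (Q k - Q (spanDim X))))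
        ≡⟨ cong (Q 0 * rankCount s 0 +_) (trans (∑ˡ-cong (allMats q s n) (λ X →
             solve 2 (λ a b → a :* (con 0ℚ :* b) := con 0ℚ) refl (𝟙 (all? X)) (Q k - Q (spanDim X)))) (∑ˡ-zero (allMats q s n))) ⟩
      Q 0 * rankCount s 0 + 0ℚ
        ≡⟨ ℚₚ.+-identityʳ _ ⟩
      Q 0 * rankCount s 0
        ≡⟨ cong (_* rankCount s 0) Q-zero ⟩
      1ℚ * rankCount s 0
        ≡⟨ ℚₚ.*-identityˡ _ ⟩
      rankCount s 0 ∎

    rankCount-suc-suc : ∀ s r → rankCount (suc s) (suc r) ≡ Q (suc r) * rankCount s (suc r) + (Q k - Q r) * rankCount s r
    rankCount-suc-suc s r = trans (rankCount-split s (suc r)) (cong (Q (suc r) * rankCount s (suc r) +_)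
      (trans (∑ˡ-cong (allMats q s n) (λ X → trans (cong (𝟙 (all? X) *_) (pull X))
               (solve 3 (λ a x c → a :* (x :* c) := c :* (a :* x)) refl (𝟙 (all? X)) (𝟙 (spanDim X ℕₚ.≟ r)) (Q k - Q r))))
             (∑ˡ-*ˡ (allMats q s n) (Q k - Q r) _)))
      where
      pull : ∀ X → 𝟙 (suc (spanDim X) ℕₚ.≟ suc r) * (Q k - Q (spanDim X)) ≡ 𝟙 (spanDim X ℕₚ.≟ r) * (Q k - Q r)
      pull X = trans (cong (_* (Q k - Q (spanDim X))) (𝟙-cong (suc (spanDim X) ℕₚ.≟ suc r) (spanDim X ℕₚ.≟ r) ℕₚ.suc-injective (cong suc)))
                     (𝟙-subst (spanDim X ℕₚ.≟ r) (λ eq → cong (λ i → Q k - Q i) eq))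

    rankCount-zero : ∀ r → rankCount 0 r ≡ 𝟙 (0 ℕₚ.≟ r)
    rankCount-zero r = begin
      𝟙 (all? []) * 𝟙 (spanDim {n} [] ℕₚ.≟ r) + 0ℚ
        ≡⟨ ℚₚ.+-identityʳ _ ⟩
      𝟙 (all? []) * 𝟙 (spanDim {n} [] ℕₚ.≟ r)
        ≡⟨ cong₂ (λ a i → a * 𝟙 (i ℕₚ.≟ r)) (𝟙-yes (all? []) [])
             (dim-unique (Span-subspace {n} []) (span? []) {0} (independent-card {n} [] (λ { [] _ → refl }))) ⟩
      1ℚ * 𝟙 (0 ℕₚ.≟ r)
        ≡⟨ ℚₚ.*-identityˡ _ ⟩
      𝟙 (0 ℕₚ.≟ r) ∎

    -- Induction on `s` along the recursion for N(s,r). The denominator `falling r r` stands on the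
    -- left, so that no quotient enters the induction.
    rankCount-falling : ∀ s r → rankCount s r * falling r r ≡ falling s r * falling k r
    rankCount-falling zero    zero    = cong (_* 1ℚ) (rankCount-zero 0)
    rankCount-falling zero    (suc r) = begin
      rankCount 0 (suc r) * falling (suc r) (suc r)   ≡⟨ cong (_* falling (suc r) (suc r)) (rankCount-zero (suc r)) ⟩
      0ℚ * falling (suc r) (suc r)                    ≡⟨ ℚₚ.*-zeroˡ (falling (suc r) (suc r)) ⟩
      0ℚ                                              ≡⟨ ℚₚ.*-zeroˡ (falling k (suc r)) ⟨
      0ℚ * falling k (suc r)                          ≡⟨ cong (_* falling k (suc r)) (falling-zero r) ⟨
      falling 0 (suc r) * falling k (suc r)           ∎
    rankCount-falling (suc s) zero    = trans (cong (_* 1ℚ) (rankCount-suc-zero s)) (rankCount-falling s zero)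
    rankCount-falling (suc s) (suc r) = begin
      rankCount (suc s) (suc r) * D
        ≡⟨ cong (_* D) (rankCount-suc-suc s r) ⟩
      (Q (suc r) * N₁ + (Q k - Q r) * N₀) * D
        ≡⟨ solve 5 (λ a n₁ b n₀ d → (a :* n₁ :+ b :* n₀) :* d := a :* (n₁ :* d) :+ b :* n₀ :* d) refl
             (Q (suc r)) N₁ (Q k - Q r) N₀ D ⟩
      Q (suc r) * (N₁ * D) + (Q k - Q r) * N₀ * D
        -- The induction hypothesis for `suc r` applies to `D` as it stands. The one for `r` needs
        -- `falling r r`, which `falling-suc r r` extracts from `D`.
        ≡⟨ cong₂ (λ a b → Q (suc r) * a + (Q k - Q r) * N₀ * b) (rankCount-falling s (suc r)) (falling-suc r r) ⟩
      Q (suc r) * (fs * (Q s - Q r) * (fk * (Q k - Q r))) + (Q k - Q r) * N₀ * ((Q (suc r) - 1ℚ) * Q r * falling r r)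
        ≡⟨ solve 7 (λ x y c n₀ z a d → x :* y :+ c :* n₀ :* (z :* a :* d) := x :* y :+ c :* z :* a :* (n₀ :* d)) refl
             (Q (suc r)) (fs * (Q s - Q r) * (fk * (Q k - Q r))) (Q k - Q r) N₀ (Q (suc r) - 1ℚ) (Q r) (falling r r) ⟩
      Q (suc r) * (fs * (Q s - Q r) * (fk * (Q k - Q r))) + (Q k - Q r) * (Q (suc r) - 1ℚ) * Q r * (N₀ * falling r r)
        ≡⟨ cong₂ (λ a b → a * (fs * (Q s - Q r) * (fk * (Q k - Q r))) + (Q k - Q r) * (a - 1ℚ) * Q r * b)
             (Q-suc r) (rankCount-falling s r) ⟩
      p * Q r * (fs * (Q s - Q r) * (fk * (Q k - Q r))) + (Q k - Q r) * (p * Q r - 1ℚ) * Q r * (fs * fk)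
        -- After the common factor `f * g * (c - a)` is removed, this is q^(r+1) (q^s - q^r) +
        -- (q^(r+1) - 1) q^r = (q^(s+1) - 1) q^r.
        ≡⟨ solve 6 (λ p a s c f g →
             p :* a :* (f :* (s :- a) :* (g :* (c :- a))) :+ (c :- a) :* (p :* a :- con 1ℚ) :* a :* (f :* g)
             := (p :* s :- con 1ℚ) :* a :* f :* (g :* (c :- a))) refl p (Q r) (Q s) (Q k) fs fk ⟩
      (p * Q s - 1ℚ) * Q r * fs * (fk * (Q k - Q r))
        ≡⟨ cong (λ a → (a - 1ℚ) * Q r * fs * (fk * (Q k - Q r))) (Q-suc s) ⟨
      (Q (suc s) - 1ℚ) * Q r * fs * (fk * (Q k - Q r))
        ≡⟨ cong (_* (fk * (Q k - Q r))) (falling-suc s r) ⟨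
      falling (suc s) (suc r) * falling k (suc r) ∎
      where
      p  = fromℕ q
      D  = falling (suc r) (suc r)
      N₁ = rankCount s (suc r)
      N₀ = rankCount s r
      fs = falling s r
      fk = falling k r

    private
      numerator : ℕ → ℕ → ℤ
      numerator s j = (ℤ.+ (q ^ s) ℤ.- ℤ.+ (q ^ j)) ℤ.* (ℤ.+ (q ^ k) ℤ.- ℤ.+ (q ^ j))

      -- The jth factor in P, for s columns; denominator-nonZero does not depend on the sequence passed to it.
      factor : ∀ s r (j : Fin r) → ℚ
      factor s r j = (numerator s (toℕ j) / (q ^ r ∸ q ^ toℕ j)) {{denominator-nonZero q (λ _ → s) r j}}

    fromℤ-numerator : ∀ s j → fromℤ (numerator s j) ≡ (Q s - Q j) * (Q k - Q j)
    fromℤ-numerator s j = trans (fromℤ-* (ℤ.+ (q ^ s) ℤ.- ℤ.+ (q ^ j)) (ℤ.+ (q ^ k) ℤ.- ℤ.+ (q ^ j)))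
      (cong₂ _*_ (fromℤ-sub (ℤ.+ (q ^ s)) (ℤ.+ (q ^ j))) (fromℤ-sub (ℤ.+ (q ^ k)) (ℤ.+ (q ^ j))))

    fromℕ-denominator : ∀ r (j : Fin r) → fromℕ (q ^ r ∸ q ^ toℕ j) ≡ Q r - Q (toℕ j)
    fromℕ-denominator r j =
      trans (cong fromℤ (trans (sym (ℤₚ.⊖-≥ (ℕₚ.^-monoʳ-≤ q (ℕₚ.<⇒≤ (Finₚ.toℕ<n j)))))
                               (sym (ℤₚ.m-n≡m⊖n (q ^ r) (q ^ toℕ j)))))
            (fromℤ-sub (ℤ.+ (q ^ r)) (ℤ.+ (q ^ toℕ j)))

    factor-* : ∀ s r (j : Fin r) → factor s r j * (Q r - Q (toℕ j)) ≡ (Q s - Q (toℕ j)) * (Q k - Q (toℕ j))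
    factor-* s r j = trans (cong (factor s r j *_) (sym (fromℕ-denominator r j)))
      (trans (/-*-cancel (numerator s (toℕ j)) (q ^ r ∸ q ^ toℕ j) {{denominator-nonZero q (λ _ → s) r j}})
             (fromℤ-numerator s (toℕ j)))

    rankRatio : ℕ → ℕ → ℚ
    rankRatio s r = ∏[ j < r ] factor s r j

    rankRatio-falling : ∀ s r → rankRatio s r * falling r r ≡ falling s r * falling k r
    rankRatio-falling s r = begin
      rankRatio s r * falling r r
        ≡⟨ cong (rankRatio s r *_) (falling-product r r) ⟩
      rankRatio s r * product {r} (λ j → Q r - Q (toℕ j))
        ≡⟨ Product.∑-distrib-+ {r} (factor s r) (λ j → Q r - Q (toℕ j)) ⟨
      product {r} (λ j → factor s r j * (Q r - Q (toℕ j)))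
        ≡⟨ Product.sum-cong-≗ {r} (factor-* s r) ⟩
      product {r} (λ j → (Q s - Q (toℕ j)) * (Q k - Q (toℕ j)))
        ≡⟨ Product.∑-distrib-+ {r} (λ j → Q s - Q (toℕ j)) (λ j → Q k - Q (toℕ j)) ⟩
      product {r} (λ j → Q s - Q (toℕ j)) * product {r} (λ j → Q k - Q (toℕ j))
        ≡⟨ cong₂ _*_ (falling-product s r) (falling-product k r) ⟨
      falling s r * falling k r ∎

    rankCount≡rankRatio : ∀ s r → rankCount s r ≡ rankRatio s r
    -- Both sides agree after multiplication by `falling r r`; to cancel it, it is presented as a
    -- nonzero natural number `D`.
    rankCount≡rankRatio s r with product-fromℕ r (λ j → q ^ r ∸ q ^ toℕ j) (denominator-nonZero q (λ _ → s) r)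
    ... | D , D≢0 , eq = *-cancelʳ-fromℕ D {{D≢0}} (begin
      rankCount s r * fromℕ D          ≡⟨ cong (rankCount s r *_) D≡falling ⟩
      rankCount s r * falling r r      ≡⟨ rankCount-falling s r ⟩
      falling s r * falling k r        ≡⟨ rankRatio-falling s r ⟨
      rankRatio s r * falling r r      ≡⟨ cong (rankRatio s r *_) D≡falling ⟨
      rankRatio s r * fromℕ D          ∎)
      where
      D≡falling : fromℕ D ≡ falling r r
      D≡falling = trans (sym eq) (trans (Product.sum-cong-≗ {r} (fromℕ-denominator r)) (sym (falling-product r r)))

-- Kernels, images and columns of matrices

module Chain (q : ℕ) .{{_ : NonTrivial q}} (q-prime : Prime q) where

  open import Data.Rational using (_+_; _*_)

  open Field q q-prime
  open Dimension q q-prime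
  open IsSubspace
  open TupleCount q q-prime

  lookup-lincomb : ∀ {n d} (c : F^ q d) (X : Vec (F^ q n) d) i →
                   Vec.lookup (lincomb q c X) i ≡ dot q (Vec.map (λ v → Vec.lookup v i) X) c
  lookup-lincomb []      []      i = Vecₚ.lookup-replicate i (0F q)
  lookup-lincomb (a ∷ c) (v ∷ X) i = trans (Vecₚ.lookup-zipWith _⊞_ i (a · v) (lincomb q c X))
    (cong₂ _⊞_ (trans (Vecₚ.lookup-map i (a ⊠_) v) (⊠-comm a (Vec.lookup v i))) (lookup-lincomb c X i))

  -- Carries the results on `lincomb` over to matrices: linearity of `mulVec`, and the image as the
  -- span of the columns.
  mulVec≡lincomb : ∀ {r c} (M : Mat q r c) x → mulVec q M x ≡ lincomb q x (Vec.transpose M)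
  mulVec≡lincomb M x = lookup-extensional (λ i → begin
    Vec.lookup (mulVec q M x) i                                         ≡⟨ Vecₚ.lookup-map i _ M ⟩
    dot q (Vec.lookup M i) x                                            ≡⟨ cong (λ A → dot q (Vec.lookup A i) x) (transpose-involutive M) ⟨
    dot q (Vec.lookup (Vec.transpose (Vec.transpose M)) i) x            ≡⟨ cong (λ row → dot q row x) (lookup-transpose (Vec.transpose M) i) ⟩
    dot q (Vec.map (λ v → Vec.lookup v i) (Vec.transpose M)) x          ≡⟨ lookup-lincomb x (Vec.transpose M) i ⟨
    Vec.lookup (lincomb q x (Vec.transpose M)) i                        ∎)

  mulVec-⊕ : ∀ {r c} (M : Mat q r c) x y → mulVec q M (x ⊕ y) ≡ mulVec q M x ⊕ mulVec q M y
  mulVec-⊕ M x y = trans (mulVec≡lincomb M (x ⊕ y)) (trans (lincomb-⊕ x y (Vec.transpose M))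
    (sym (cong₂ _⊕_ (mulVec≡lincomb M x) (mulVec≡lincomb M y))))

  mulVec-· : ∀ {r c} (M : Mat q r c) a x → mulVec q M (a · x) ≡ a · mulVec q M x
  mulVec-· M a x = trans (mulVec≡lincomb M (a · x)) (trans (lincomb-· a x (Vec.transpose M))
    (cong (a ·_) (sym (mulVec≡lincomb M x))))

  mulVec-0V : ∀ {r c} (M : Mat q r c) → mulVec q M (0V q) ≡ 0V q
  mulVec-0V M = trans (mulVec≡lincomb M (0V q)) (lincomb-0V (Vec.transpose M))

  ker? : ∀ {r c} (M : Mat q r c) → Decidable (Ker q M)
  ker? M x = mulVec q M x ≟ⱽ 0V q

  im? : ∀ {r c} (M : Mat q r c) → Decidable (Im q M)
  im? M y = ∃? (allF^-complete q) (λ x → mulVec q M x ≟ⱽ y)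

  Ker-subspace : ∀ {r c} (M : Mat q r c) → IsSubspace (Ker q M)
  Ker-subspace M .0V-closed = mulVec-0V M
  Ker-subspace M .⊕-closed {u} {v} u∈ v∈ = trans (mulVec-⊕ M u v) (trans (cong₂ _⊕_ u∈ v∈) (⊕-identityˡ (0V q)))
  Ker-subspace M .·-closed a {v} v∈ = trans (mulVec-· M a v) (trans (cong (a ·_) v∈) (·-zeroʳ a))

  Im-subspace : ∀ {r c} (M : Mat q r c) → IsSubspace (Im q M)
  Im-subspace M .0V-closed = 0V q , mulVec-0V M
  Im-subspace M .⊕-closed (x , refl) (y , refl) = x ⊕ y , mulVec-⊕ M x y
  Im-subspace M .·-closed a (x , refl) = a · x , mulVec-· M a x

  rank≡spanDim : ∀ {r c} (M : Mat q r c) → rank q M ≡ spanDim (Vec.transpose M)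
  rank≡spanDim M = dim-cong (im? M) (span? (Vec.transpose M)) (Im-subspace M) (Span-subspace (Vec.transpose M))
    (λ _ (x , eq) → x , trans (sym (mulVec≡lincomb M x)) eq)
    (λ _ (x , eq) → x , trans (mulVec≡lincomb M x) eq)

  nul+rank : ∀ {r c} (M : Mat q r c) → nul q M ℕ.+ rank q M ≡ c
  nul+rank {c = c} M = q^-injective (begin
    q ^ (nul q M ℕ.+ rank q M)        ≡⟨ ℕₚ.^-distribˡ-+-* q (nul q M) (rank q M) ⟩
    q ^ nul q M ℕ.* q ^ rank q M      ≡⟨ cong₂ ℕ._*_ (card-dim (Ker-subspace M) (ker? M)) (card-dim (Im-subspace M) (im? M)) ⟨
    card (ker? M) ℕ.* card (im? M)    ≡⟨ card-kernel-image (mulVec q M) (mulVec-⊕ M) (im? M) ⟩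
    q ^ c                             ∎)

  nul≤ : ∀ {r c} (M : Mat q r c) → nul q M ≤ c
  nul≤ M = dim≤ (ker? M)

  -- The rank is bounded by the dimension 0 of the target, so rank-nullity leaves everything to the
  -- kernel.
  nul-emptyTarget : ∀ {c} (M : Mat q 0 c) → nul q M ≡ c
  nul-emptyTarget M = trans (sym (ℕₚ.+-identityʳ _))
    (trans (cong (nul q M ℕ.+_) (sym (ℕₚ.n≤0⇒n≡0 (dim≤ (im? M))))) (nul+rank M))

  module _ {r s c} (M : Mat q r s) (N : Mat q s c) where

    private
      lookup²-mulMat : ∀ i j → Vec.lookup (Vec.lookup (mulMat q M N) i) j ≡
                               Vec.lookup (mulVec q M (Vec.lookup (Vec.transpose N) j)) i
      lookup²-mulMat i j = begin
        Vec.lookup (Vec.lookup (mulMat q M N) i) j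
          ≡⟨ cong (λ v → Vec.lookup v j) (Vecₚ.lookup-map i _ M) ⟩
        Vec.lookup (Vec.map (dot q (Vec.lookup M i)) (Vec.transpose N)) j
          ≡⟨ Vecₚ.lookup-map j _ (Vec.transpose N) ⟩
        dot q (Vec.lookup M i) (Vec.lookup (Vec.transpose N) j)
          ≡⟨ Vecₚ.lookup-map i _ M ⟨
        Vec.lookup (mulVec q M (Vec.lookup (Vec.transpose N) j)) i ∎

    mulMat≡0⇒columns∈Ker : mulMat q M N ≡ 0M q → All (Ker q M) (Vec.transpose N)
    mulMat≡0⇒columns∈Ker eq = Allₚ.lookup⁻ (λ j → lookup-extensional (λ i → begin
      Vec.lookup (mulVec q M (Vec.lookup (Vec.transpose N) j)) i  ≡⟨ lookup²-mulMat i j ⟨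
      Vec.lookup (Vec.lookup (mulMat q M N) i) j                  ≡⟨ cong (λ A → Vec.lookup (Vec.lookup A i) j) eq ⟩
      Vec.lookup (Vec.lookup (0M q {r} {c}) i) j                  ≡⟨ cong (λ v → Vec.lookup v j) (Vecₚ.lookup-replicate i (0V q)) ⟩
      Vec.lookup (0V q {c}) j                                     ≡⟨ Vecₚ.lookup-replicate j (0F q) ⟩
      0F q                                                        ≡⟨ Vecₚ.lookup-replicate i (0F q) ⟨
      Vec.lookup (0V q {r}) i                                     ∎))

    columns∈Ker⇒mulMat≡0 : All (Ker q M) (Vec.transpose N) → mulMat q M N ≡ 0M q
    columns∈Ker⇒mulMat≡0 cols = lookup-extensional (λ i → lookup-extensional (λ j → begin
      Vec.lookup (Vec.lookup (mulMat q M N) i) j                  ≡⟨ lookup²-mulMat i j ⟩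
      Vec.lookup (mulVec q M (Vec.lookup (Vec.transpose N) j)) i  ≡⟨ cong (λ v → Vec.lookup v i) (Allₚ.lookup⁺ cols j) ⟩
      Vec.lookup (0V q {r}) i                                     ≡⟨ Vecₚ.lookup-replicate i (0F q) ⟩
      0F q                                                        ≡⟨ Vecₚ.lookup-replicate j (0F q) ⟨
      Vec.lookup (0V q {c}) j                                     ≡⟨ cong (λ v → Vec.lookup v j) (Vecₚ.lookup-replicate i (0V q)) ⟨
      Vec.lookup (Vec.lookup (0M q {r} {c}) i) j                  ∎))

  allMats-enumerates : ∀ r c → Enumerates (allMats q r c)
  allMats-enumerates r c = allVecs-enumerates (allF^-enumerates c) r

  ∑-transpose : ∀ {r c} (f : Mat q c r → ℚ) → ∑ˡ (allMats q r c) (f ∘ Vec.transpose) ≡ ∑ˡ (allMats q c r) f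
  ∑-transpose {r} {c} = ∑ˡ-reindex (allMats-enumerates r c) (allMats-enumerates c r)
    Vec.transpose Vec.transpose transpose-involutive transpose-involutive

  -- The laws of rank and nullity along the complex

  module _ (n : ℕ → ℕ) where

    module _ {r} m (M : Mat q r (n m)) where

      private
        s k : ℕ
        s = n (suc m)
        k = nul q M

        next : List (Mat q (n m) s)
        next = nextMats q n m M

        -- Transposition turns the single equation A_m A_{m+1} = 0 into a condition on each column
        -- separately, which is the setting of `tuple-count` and `rankCount`.
        ∑-next : (f : Mat q s (n m) → ℚ) →
                 ∑ˡ next (f ∘ Vec.transpose) ≡ ∑ˡ (allMats q s (n m)) (λ X → 𝟙 (All.all? (ker? M) X) * f X)
        ∑-next f = begin
          ∑ˡ next (f ∘ Vec.transpose)
            ≡⟨ ∑ˡ-filter (λ N → _≟M_ q (mulMat q M N) (0M q)) (allMats q (n m) s) _ ⟩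
          ∑ˡ (allMats q (n m) s) (λ N → 𝟙 (_≟M_ q (mulMat q M N) (0M q)) * f (Vec.transpose N))
            ≡⟨ ∑ˡ-cong (allMats q (n m) s) (λ N → cong (_* f (Vec.transpose N))
                 (𝟙-cong (_≟M_ q (mulMat q M N) (0M q)) (All.all? (ker? M) (Vec.transpose N))
                   (mulMat≡0⇒columns∈Ker M N) (columns∈Ker⇒mulMat≡0 M N))) ⟩
          ∑ˡ (allMats q (n m) s) (λ N → 𝟙 (All.all? (ker? M) (Vec.transpose N)) * f (Vec.transpose N))
            ≡⟨ ∑-transpose (λ X → 𝟙 (All.all? (ker? M) X) * f X) ⟩
          ∑ˡ (allMats q s (n m)) (λ X → 𝟙 (All.all? (ker? M) X) * f X) ∎

        length-next : fromℕ (List.length next) ≡ Q (k ℕ.* s)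
        length-next = begin
          fromℕ (List.length next)
            ≡⟨ ∑ˡ-length next ⟨
          ∑ˡ next (λ _ → 1ℚ)
            ≡⟨ ∑-next (λ _ → 1ℚ) ⟩
          ∑ˡ (allMats q s (n m)) (λ X → 𝟙 (All.all? (ker? M) X) * 1ℚ)
            ≡⟨ ∑ˡ-cong (allMats q s (n m)) (λ X → ℚₚ.*-identityʳ _) ⟩
          ∑ˡ (allMats q s (n m)) (λ X → 𝟙 (All.all? (ker? M) X))
            ≡⟨ tuple-count (Ker-subspace M) (ker? M) s ⟩
          Q (k ℕ.* s) ∎

        ∑-rank : ∀ ρ → ∑ˡ next (λ N → 𝟙 (rank q N ℕₚ.≟ ρ)) ≡ rankCount (Ker-subspace M) (ker? M) s ρ
        ∑-rank ρ = trans (∑ˡ-cong next (λ N → cong (λ i → 𝟙 (i ℕₚ.≟ ρ)) (rank≡spanDim N)))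
                         (∑-next (λ X → 𝟙 (spanDim X ℕₚ.≟ ρ)))

      -- There are q^(ks) admissible matrices. Multiplying by this number turns the left side into
      -- `rankCount` and clears the prefactor `w` of P on the right.
      𝔼-rank : ∀ ρ → 𝔼 (uniform next) (λ N → 𝟙 (rank q N ℕₚ.≟ ρ)) ≡ P q n m k (ℤ.+ ρ)
      𝔼-rank ρ = *-cancelʳ-fromℕ (q ^ (k ℕ.* s)) {{ℕₚ.m^n≢0 q (k ℕ.* s)}} (begin
        𝔼 (uniform next) (λ N → 𝟙 (rank q N ℕₚ.≟ ρ)) * Q (k ℕ.* s)
          ≡⟨ cong (𝔼 (uniform next) (λ N → 𝟙 (rank q N ℕₚ.≟ ρ)) *_) length-next ⟨
        𝔼 (uniform next) (λ N → 𝟙 (rank q N ℕₚ.≟ ρ)) * fromℕ (List.length next)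
          ≡⟨ 𝔼-uniform next _ ⟩
        ∑ˡ next (λ N → 𝟙 (rank q N ℕₚ.≟ ρ))
          ≡⟨ trans (∑-rank ρ) (rankCount≡rankRatio (Ker-subspace M) (ker? M) s ρ) ⟩
        G
          ≡⟨ ℚₚ.*-identityʳ G ⟨
        G * 1ℚ
          ≡⟨ cong (G *_) (trans (/-*-cancel (ℤ.+ 1) (q ^ (k ℕ.* s)) {{ℕₚ.m^n≢0 q (k ℕ.* s)}}) fromℤ-1) ⟨
        G * (w * Q (k ℕ.* s))
          ≡⟨ solve 3 (λ g w x → g :* (w :* x) := w :* g :* x) refl G w (Q (k ℕ.* s)) ⟩
        w * G * Q (k ℕ.* s) ∎)
        where
        G w : ℚ
        G = rankRatio (Ker-subspace M) (ker? M) s ρ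
        w = (ℤ.+ 1 / (q ^ (k ℕ.* s))) {{ℕₚ.m^n≢0 q (k ℕ.* s)}}

      -- The event is that the rank equals `+ k - b`, an integer of either sign. `by-sign` takes it
      -- as a variable `z` together with an equation so that P can reduce on its constructor.
      𝔼-betti : ∀ b → 𝔼 (uniform next) (λ N → 𝟙 (k ⊖ rank q N ℤₚ.≟ b)) ≡ P q n m k (ℤ.+ k ℤ.- b)
      𝔼-betti b = by-sign (ℤ.+ k ℤ.- b) refl
        where
        to : ∀ {ρ} → k ⊖ ρ ≡ b → ℤ.+ ρ ≡ ℤ.+ k ℤ.- b
        to {ρ} refl = begin
          ℤ.+ ρ                                    ≡⟨ ℤₚ.neg-involutive (ℤ.+ ρ) ⟨
          ℤ.- (ℤ.- ℤ.+ ρ)                          ≡⟨ ℤₚ.+-identityˡ _ ⟨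
          ℤ.+ 0 ℤ.+ ℤ.- (ℤ.- ℤ.+ ρ)                ≡⟨ cong (ℤ._+ ℤ.- (ℤ.- ℤ.+ ρ)) (ℤₚ.+-inverseʳ (ℤ.+ k)) ⟨
          ℤ.+ k ℤ.- ℤ.+ k ℤ.+ ℤ.- (ℤ.- ℤ.+ ρ)      ≡⟨ ℤₚ.+-assoc (ℤ.+ k) (ℤ.- ℤ.+ k) _ ⟩
          ℤ.+ k ℤ.+ (ℤ.- ℤ.+ k ℤ.+ ℤ.- (ℤ.- ℤ.+ ρ)) ≡⟨ cong (λ z → ℤ.+ k ℤ.+ z) (ℤₚ.neg-distrib-+ (ℤ.+ k) (ℤ.- ℤ.+ ρ)) ⟨
          ℤ.+ k ℤ.- (ℤ.+ k ℤ.- ℤ.+ ρ)              ≡⟨ cong (λ z → ℤ.+ k ℤ.- z) (ℤₚ.m-n≡m⊖n k ρ) ⟩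
          ℤ.+ k ℤ.- (k ⊖ ρ)                        ∎
        from : ∀ {ρ} → ℤ.+ ρ ≡ ℤ.+ k ℤ.- b → k ⊖ ρ ≡ b
        from {ρ} eq = begin
          k ⊖ ρ                                    ≡⟨ ℤₚ.m-n≡m⊖n k ρ ⟨
          ℤ.+ k ℤ.- ℤ.+ ρ                          ≡⟨ cong (λ z → ℤ.+ k ℤ.- z) eq ⟩
          ℤ.+ k ℤ.- (ℤ.+ k ℤ.- b)                  ≡⟨ cong (λ z → ℤ.+ k ℤ.+ z) (ℤₚ.neg-distrib-+ (ℤ.+ k) (ℤ.- b)) ⟩
          ℤ.+ k ℤ.+ (ℤ.- ℤ.+ k ℤ.+ ℤ.- (ℤ.- b))    ≡⟨ ℤₚ.+-assoc (ℤ.+ k) (ℤ.- ℤ.+ k) _ ⟨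
          ℤ.+ k ℤ.- ℤ.+ k ℤ.+ ℤ.- (ℤ.- b)          ≡⟨ cong (ℤ._+ ℤ.- (ℤ.- b)) (ℤₚ.+-inverseʳ (ℤ.+ k)) ⟩
          ℤ.+ 0 ℤ.+ ℤ.- (ℤ.- b)                    ≡⟨ ℤₚ.+-identityˡ _ ⟩
          ℤ.- (ℤ.- b)                              ≡⟨ ℤₚ.neg-involutive b ⟩
          b                                        ∎
        by-sign : ∀ z → z ≡ ℤ.+ k ℤ.- b → 𝔼 (uniform next) (λ N → 𝟙 (k ⊖ rank q N ℤₚ.≟ b)) ≡ P q n m k z
        by-sign (ℤ.+ ρ) eq = trans
          (𝔼-cong (uniform next) (λ N → 𝟙-cong (k ⊖ rank q N ℤₚ.≟ b) (rank q N ℕₚ.≟ ρ)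
            (λ h → ℤₚ.+-injective (trans (to {rank q N} h) (sym eq)))
            (λ h → from (trans (cong ℤ.+_ h) eq))))
          (𝔼-rank ρ)
        -- If `k` is less than `b`, no rank fulfils the condition, and P is 0 by definition.
        by-sign -[1+ _ ] eq = trans
          (∑ˡ-cong (uniform next) (λ (N , p) →
            trans (cong (p *_) (𝟙-no (k ⊖ rank q N ℤₚ.≟ b) (λ h → contradiction (trans (to {rank q N} h) (sym eq)) (λ ()))))
                  (ℚₚ.*-zeroʳ p)))
          (∑ˡ-zero (uniform next))

    𝔼-chainLaw-suc : ∀ m (f : Matrices q n (suc m) → ℚ) → 𝔼 (chainLaw q n (suc m)) f ≡
      𝔼 (chainLaw q n m) (λ As → 𝔼 (uniform (nextMats q n m (last q n m As))) (λ N → f (As , N)))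
    𝔼-chainLaw-suc m f = trans (𝔼->>= (chainLaw q n m) _ f)
      (𝔼-cong (chainLaw q n m) (λ As → 𝔼-map (As ,_) (uniform (nextMats q n m (last q n m As))) f))

    -- Conditionally on A_m, rank A_{m+1} has law P; rank-nullity turns this into the law of nul A_{m+1}.
    mutual
      nested-law : ∀ m r → 𝔼 (chainLaw q n m) (λ As → P q n m (nul q (last q n m As)) r) ≡ nested q n m r
      -- `chainLaw q n 0` is a point mass at the zero map, whose kernel has dimension `n 0`; this is
      -- the end `i_0 = n_0` of the nested sums.
      nested-law zero    r = trans (ℚₚ.+-identityʳ _) (trans (ℚₚ.*-identityˡ _)
        (cong (λ k → P q n 0 k r) (nul-emptyTarget (0M q))))
      nested-law (suc m) r = nul-law m (λ k → P q n (suc m) k r)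

      -- The function `g` is arbitrary because P is averaged in two ways: `nested-law` keeps the
      -- rank argument `r` fixed, whereas for the Betti number the argument `+ k - b` varies with
      -- the nullity `k`.
      nul-law : ∀ m (g : ℕ → ℚ) → 𝔼 (chainLaw q n (suc m)) (λ As → g (nul q (last q n (suc m) As))) ≡
                ∑[ i < suc (n (suc m)) ] (g (toℕ i) * nested q n m (n (suc m) ⊖ toℕ i))
      nul-law m g = begin
        𝔼 (chainLaw q n (suc m)) (λ As → g (nul q (last q n (suc m) As)))
          -- The nullity is at most the number `N` of columns, so the `suc N` values from 0 to `N`
          -- exhaust it.
          ≡⟨ 𝔼-cong (chainLaw q n (suc m)) (λ As → sum-𝟙 (suc N) g (ℕ.s≤s (nul≤ (last q n (suc m) As)))) ⟨
        𝔼 (chainLaw q n (suc m)) (λ As → ∑[ i < suc N ] (g (toℕ i) * 𝟙 (nul q (last q n (suc m) As) ℕₚ.≟ toℕ i)))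
          ≡⟨ 𝔼-sum (chainLaw q n (suc m)) (suc N) (λ i As → g (toℕ i) * 𝟙 (nul q (last q n (suc m) As) ℕₚ.≟ toℕ i)) ⟩
        ∑[ i < suc N ] 𝔼 (chainLaw q n (suc m)) (λ As → g (toℕ i) * 𝟙 (nul q (last q n (suc m) As) ℕₚ.≟ toℕ i))
          ≡⟨ Sum.sum-cong-≗ {suc N} (λ i → trans (pull-out (toℕ i)) (cong (g (toℕ i) *_) (nul-prob (toℕ i) (toℕ≤ i)))) ⟩
        ∑[ i < suc N ] (g (toℕ i) * nested q n m (N ⊖ toℕ i)) ∎
        where
        N = n (suc m)

        toℕ≤ : (i : Fin (suc N)) → toℕ i ≤ N
        toℕ≤ i = ℕ.s≤s⁻¹ (Finₚ.toℕ<n i)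

        pull-out : ∀ i → 𝔼 (chainLaw q n (suc m)) (λ As → g i * 𝟙 (nul q (last q n (suc m) As) ℕₚ.≟ i)) ≡
                         g i * 𝔼 (chainLaw q n (suc m)) (λ As → 𝟙 (nul q (last q n (suc m) As) ℕₚ.≟ i))
        pull-out i = trans
          (∑ˡ-cong (chainLaw q n (suc m)) (λ (As , p) → solve 3 (λ p g x → p :* (g :* x) := g :* (p :* x)) refl
            p (g i) (𝟙 (nul q (last q n (suc m) As) ℕₚ.≟ i))))
          (∑ˡ-*ˡ (chainLaw q n (suc m)) (g i) _)

        nul⇔rank : ∀ {i} → i ≤ N → (M : Mat q (n m) N) → 𝟙 (nul q M ℕₚ.≟ i) ≡ 𝟙 (rank q M ℕₚ.≟ N ∸ i)
        nul⇔rank {i} i≤N M = 𝟙-cong (nul q M ℕₚ.≟ i) (rank q M ℕₚ.≟ N ∸ i)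
          (λ { refl → trans (sym (ℕₚ.m+n∸m≡n (nul q M) (rank q M))) (cong (_∸ nul q M) (nul+rank M)) })
          (λ eq → ℕₚ.+-cancelʳ-≡ (N ∸ i) (nul q M) i
            (trans (cong (nul q M ℕ.+_) (sym eq)) (trans (nul+rank M) (sym (ℕₚ.m+[n∸m]≡n i≤N)))))

        nul-prob : ∀ i → i ≤ N → 𝔼 (chainLaw q n (suc m)) (λ As → 𝟙 (nul q (last q n (suc m) As) ℕₚ.≟ i)) ≡
                                nested q n m (N ⊖ i)
        nul-prob i i≤N = begin
          𝔼 (chainLaw q n (suc m)) (λ As → 𝟙 (nul q (last q n (suc m) As) ℕₚ.≟ i))
            ≡⟨ 𝔼-cong (chainLaw q n (suc m)) (λ As → nul⇔rank i≤N (last q n (suc m) As)) ⟩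
          𝔼 (chainLaw q n (suc m)) (λ As → 𝟙 (rank q (last q n (suc m) As) ℕₚ.≟ N ∸ i))
            ≡⟨ 𝔼-chainLaw-suc m _ ⟩
          𝔼 (chainLaw q n m) (λ As → 𝔼 (uniform (nextMats q n m (last q n m As))) (λ M → 𝟙 (rank q M ℕₚ.≟ N ∸ i)))
            ≡⟨ 𝔼-cong (chainLaw q n m) (λ As → 𝔼-rank m (last q n m As) (N ∸ i)) ⟩
          𝔼 (chainLaw q n m) (λ As → P q n m (nul q (last q n m As)) (ℤ.+ (N ∸ i)))
            ≡⟨ nested-law m (ℤ.+ (N ∸ i)) ⟩
          nested q n m (ℤ.+ (N ∸ i))
            ≡⟨ cong (nested q n m) (ℤₚ.⊖-≥ i≤N) ⟨
          nested q n m (N ⊖ i) ∎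

-- The law of the Betti number

open import Data.Integer using (+_; _-_; _≟_)
open import Data.Rational using (_*_)

theorem1 : (q : ℕ) .{{_ : NonTrivial q}} → Prime q →
    (n : ℕ → ℕ) (m : ℕ) → 1 ≤ m → (b : ℤ) →
    Prob (chainLaw q n (suc m)) (λ As → β q n m As ≟ b) ≡
    ∑[ i < suc (n m) ] (P q n m (toℕ i) (+ toℕ i - b) * nested q n (m ∸ 1) (n m ⊖ toℕ i))
theorem1 q q-prime n (suc m) _ b = begin
  Prob (chainLaw q n (suc (suc m))) (λ As → β q n (suc m) As ≟ b)
    ≡⟨ Prob≡𝔼 (chainLaw q n (suc (suc m))) (λ As → β q n (suc m) As ≟ b) ⟩
  𝔼 (chainLaw q n (suc (suc m))) (λ As → 𝟙 (β q n (suc m) As ≟ b))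
    ≡⟨ 𝔼-chainLaw-suc n (suc m) _ ⟩
  𝔼 (chainLaw q n (suc m)) (λ As → 𝔼 (uniform (nextMats q n (suc m) (last q n (suc m) As)))
    (λ M → 𝟙 (nul q (last q n (suc m) As) ⊖ rank q M ≟ b)))
    ≡⟨ 𝔼-cong (chainLaw q n (suc m)) (λ As → 𝔼-betti n (suc m) (last q n (suc m) As) b) ⟩
  𝔼 (chainLaw q n (suc m)) (λ As → P q n (suc m) (nul q (last q n (suc m) As)) (+ nul q (last q n (suc m) As) - b))
    ≡⟨ nul-law n m (λ k → P q n (suc m) k (+ k - b)) ⟩
  ∑[ i < suc (n (suc m)) ] (P q n (suc m) (toℕ i) (+ toℕ i - b) * nested q n m (n (suc m) ⊖ toℕ i)) ∎
  where open Chain q q-prime
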